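{- Every $(4K_1, C_4, P_6)$-free graph that contains $C_6$ as an induced subgraph has clique-width at most $27$. (In particular, the class of $(4K_1, C_4, P_6)$-free graphs that contain a $C_6$ has bounded clique-width.)
   Context: Graphs are finite and simple. For a set $L$ of graphs, a graph $G$ is $L$-free if it contains no induced subgraph isomorphic to a member of $L$. $4K_1$ is the edgeless graph on four vertices, $C_k$ is the chordless cycle on $k$ vertices, and $P_k$ is the chordless path on $k$ vertices. The clique-width of a graph $G$ is the minimum number of labels needed to build $G$ (with labels forgotten at the end) by the following four operations: (1) create a vertex with label $i$; (2) take the disjoint union of two previously constructed labelled graphs; (3) for some $i \neq j$, join by an edge every vertex with label $i$ to every vertex with label $j$; (4) relabel all vertices with label $i$ by label $j$. -}

module Defs where

open import Data.Empty using (⊥)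
open import Data.Unit using (⊤)
open import Data.Bool using (if_then_else_)
open import Data.Nat using (ℕ; suc; _≤_; _≤?_)
import Data.Nat.Properties as ℕ
open import Data.Fin using (Fin; toℕ; _≟_)
open import Data.List using (List)
open import Data.List.Relation.Unary.All using (All)
open import Data.Product using (Σ-syntax; ∃-syntax; _×_; _,_)
open import Data.Sum using (_⊎_; inj₁; inj₂; [_,_]; swap)
open import Data.Sum.Relation.Binary.Pointwise using (Pointwise)
open import Function using (id; _⇔_; _↔_; _↣_; Inverse; Injection)
open import Level using (0ℓ)
open import Relation.Binary using (Rel; Decidable; Irreflexive; Symmetric)
open import Relation.Binary.PropositionalEquality using (_≡_; _≢_; refl; sym; trans; cong)
open import Relation.Nullary using (¬_; does; _×-dec_; _⊎-dec_; no)
open import Relation.Nullary.Decidable using (True; toWitness)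
open import Relation.Unary using (Pred)

record Graph : Set₁ where
  field
    order  : ℕ
    Adj    : Rel (Fin order) 0ℓ
    adj?   : Decidable Adj
    symm   : Symmetric Adj
    irrefl : Irreflexive _≡_ Adj

  Vertex : Set
  Vertex = Fin order

open Graph

-- H ⊑ G: some induced subgraph of G is isomorphic to H.
_⊑_ : Graph → Graph → Set
H ⊑ G = Σ[ f ∈ Vertex H ↣ Vertex G ]
        (∀ u v → Adj H u v ⇔ Adj G (Injection.to f u) (Injection.to f v))

_-Free_ : List Graph → Graph → Set₁
L -Free G = All (λ H → ¬ (H ⊑ G)) L

_K₁ : ℕ → Graph
n K₁ = record
  { order  = n
  ; Adj    = λ _ _ → ⊥
  ; adj?   = λ _ _ → no id
  ; symm   = id
  ; irrefl = λ _ ()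
  }

module _ {n : ℕ} where

  PathStep : Rel (Fin n) 0ℓ
  PathStep u v = suc (toℕ u) ≡ toℕ v

  CycleStep : Rel (Fin n) 0ℓ
  CycleStep u v = PathStep u v ⊎ (suc (toℕ u) ≡ n × toℕ v ≡ 0)

  pathStep? : Decidable PathStep
  pathStep? u v = suc (toℕ u) ℕ.≟ toℕ v

  cycleStep? : Decidable CycleStep
  cycleStep? u v = pathStep? u v ⊎-dec (suc (toℕ u) ℕ.≟ n ×-dec toℕ v ℕ.≟ 0)

  pathStep-irrefl : ∀ {u} → ¬ PathStep u u
  pathStep-irrefl = ℕ.1+n≢n

  cycleStep-irrefl : 3 ≤ n → ∀ {u} → ¬ CycleStep u u
  cycleStep-irrefl _   (inj₁ s)             = pathStep-irrefl s
  cycleStep-irrefl 3≤n (inj₂ (1+u≡n , u≡0)) =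
    ℕ.<⇒≱ 3≤n (ℕ.≤-trans (ℕ.≤-reflexive (trans (sym 1+u≡n) (cong suc u≡0))) (ℕ.n≤1+n 1))

P : ℕ → Graph
P n = record
  { order  = n
  ; Adj    = λ u v → PathStep u v ⊎ PathStep v u
  ; adj?   = λ u v → pathStep? u v ⊎-dec pathStep? v u
  ; symm   = swap
  ; irrefl = λ { {u} refl → [ pathStep-irrefl {u = u} , pathStep-irrefl {u = u} ] }
  }

C : (n : ℕ) → {True (3 ≤? n)} → Graph
C n {3≤n} = record
  { order  = n
  ; Adj    = λ u v → CycleStep u v ⊎ CycleStep v u
  ; adj?   = λ u v → cycleStep? u v ⊎-dec cycleStep? v u
  ; symm   = swap
  ; irrefl = λ { {u} refl → [ loopless {u} , loopless {u} ] }
  }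
  where
  loopless : ∀ {u} → ¬ CycleStep u u
  loopless = cycleStep-irrefl (toWitness 3≤n)

record LabelledGraph (k : ℕ) : Set₁ where
  field
    Vertexˡ : Set
    Adjˡ    : Rel Vertexˡ 0ℓ
    label   : Vertexˡ → Fin k

open LabelledGraph

data Expr (k : ℕ) : Set where
  vertex  : Fin k → Expr k
  _⊕_     : Expr k → Expr k → Expr k
  join    : (i j : Fin k) → i ≢ j → Expr k → Expr k
  relabel : (i j : Fin k) → Expr k → Expr k

⟦_⟧ : ∀ {k} → Expr k → LabelledGraph k
⟦ vertex i ⟧ = record
  { Vertexˡ = ⊤
  ; Adjˡ    = λ _ _ → ⊥
  ; label   = λ _ → i
  }
⟦ e ⊕ f ⟧ = record
  { Vertexˡ = Vertexˡ ⟦ e ⟧ ⊎ Vertexˡ ⟦ f ⟧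
  ; Adjˡ    = Pointwise (Adjˡ ⟦ e ⟧) (Adjˡ ⟦ f ⟧)
  ; label   = [ label ⟦ e ⟧ , label ⟦ f ⟧ ]
  }
⟦ join i j _ e ⟧ = record
  { Vertexˡ = Vertexˡ ⟦ e ⟧
  ; Adjˡ    = λ u v → Adjˡ ⟦ e ⟧ u v
                    ⊎ (label ⟦ e ⟧ u ≡ i × label ⟦ e ⟧ v ≡ j)
                    ⊎ (label ⟦ e ⟧ u ≡ j × label ⟦ e ⟧ v ≡ i)
  ; label   = label ⟦ e ⟧
  }
⟦ relabel i j e ⟧ = record
  { Vertexˡ = Vertexˡ ⟦ e ⟧
  ; Adjˡ    = Adjˡ ⟦ e ⟧
  ; label   = λ v → if does (label ⟦ e ⟧ v ≟ i) then j else label ⟦ e ⟧ v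
  }

-- Isomorphism after forgetting the labels.
_≅_ : ∀ {k} → LabelledGraph k → Graph → Set
X ≅ G = Σ[ f ∈ Vertexˡ X ↔ Vertex G ]
        (∀ u v → Adjˡ X u v ⇔ Adj G (Inverse.to f u) (Inverse.to f v))

ConstructibleWith : ℕ → Graph → Set
ConstructibleWith k G = Σ[ e ∈ Expr k ] ⟦ e ⟧ ≅ G

-- The minimum number of labels.  A relation rather than a function, since the
-- graph of order 0 has no expression at all.
IsCliqueWidth : Graph → ℕ → Set
IsCliqueWidth G w = ConstructibleWith w G × (∀ k → ConstructibleWith k G → w ≤ k)

CliqueWidth≤ : Graph → ℕ → Set
CliqueWidth≤ G k = ∃[ w ] IsCliqueWidth G w × w ≤ k

BoundedCliqueWidth : ∀ {ℓ} → Pred Graph ℓ → Set _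
BoundedCliqueWidth 𝒞 = ∃[ k ] (∀ G → 𝒞 G → CliqueWidth≤ G k)

{-# OPTIONS --safe #-}
module Submission where

-- Let v₀, …, v₅ be an induced C₆ in G.  Since G is (4K₁, C₄, P₆)-free, the vertices of G fall
-- into cliques according to their neighbours on the cycle: A_i sees v_{i-1}, v_i, v_{i+1} (v_i
-- itself is put into A_i), B_i sees v_i, …, v_{i+3}, D_i sees v_i and v_{i+3}, F sees the whole
-- cycle, and only one D_i, up to i = i + 3, is nonempty.  Two classes are complete or
-- anticomplete to each other, except for the pairs A_i, A_{i±2} and A_i, B_i and A_i, B_{i+3},
-- whose bipartite graph has nested neighbourhoods because it contains no C₄.
--
-- Split A_i into the vertices with a neighbour in A_{i+2}, the others with a neighbour in
-- A_{i-2}, and the rest.  With the six B_i, D and F this gives 26 tags.  Every nonempty set S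
-- of vertices has a vertex x that treats, for each tag, all vertices of S with that tag alike:
-- as long as S has vertices of the first two kinds, they are mixed on only one tag each, and an
-- extreme vertex of the corresponding nested pair serves as x; afterwards an extreme vertex
-- between some B_i and A_i or A_{i+3} does.  Removing such vertices one at a time and
-- reversing, G is built with one label per tag and one label for the vertex being inserted.
--
-- Having width at most k is decidable by saturating the finite set of partial constructions
-- on the vertices of G, so the minimum in the definition of clique-width exists constructively.

open import Defs
open import Data.Bool using (Bool; true; false; T; T?; if_then_else_; _∨_; _∧_; not)
open import Data.Bool.Properties using (T-∨; T-∧)
import Data.Bool.Properties as Bool
open import Data.Empty using (⊥-elim; ⊥)
open import Data.Fin using (Fin; _≟_; zero; suc; toℕ; #_; combine; remQuot; splitAt; _↑ˡ_; _↑ʳ_)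
open import Data.Fin.Properties using (any?; all?; suc-injective; splitAt-↑ˡ; remQuot-combine)
open import Data.Fin.Subset using (Subset; _-_; ∣_∣; Nonempty) renaming (_∈_ to _∈ˢ_; ⊤ to full)
open import Data.Fin.Subset.Properties using (_∈?_; nonempty?; ∈⊤; x∈p⇒∣p-x∣<∣p∣; x∈p∧x≢y⇒x∈p-y; p─q⊆p)
open import Data.List using (List; []; _∷_; length; cartesianProduct; cartesianProductWith; filter; allFin)
import Data.List as List
open import Data.List.Membership.Propositional using (_∈_; lose; find)
open import Data.List.Membership.Propositional.Properties
  using (∈-cartesianProduct⁺; ∈-cartesianProductWith⁺; ∈-allFin; ∈-map⁺; ∈-filter⁺; ∈-filter⁻)
open import Data.List.Relation.Unary.All using (All; []; _∷_)
import Data.List.Relation.Unary.All as All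
open import Data.List.Relation.Unary.All.Properties using (all-filter)
open import Data.List.Relation.Unary.AllPairs using (AllPairs; []; _∷_)
open import Data.List.Relation.Unary.Any using (Any; here; there)
import Data.List.Relation.Unary.Any as Any
open import Data.Maybe using (Maybe; just; nothing; _<∣>_)
import Data.Maybe as Maybe
import Data.Maybe.Properties as Maybe
open import Data.Nat using (ℕ; zero; suc; s≤s; _≤_; _<_; _+_; _∸_)
open import Data.Nat.DivMod using (_mod_)
open import Data.Nat.Induction using (<-wellFounded)
import Data.Nat.Properties as ℕ
open import Data.Product using (∃; ∃₂; _×_; _,_; proj₁; proj₂; uncurry)
import Data.Product.Properties as Product
open import Data.Sum using (_⊎_; inj₁; inj₂; [_,_]′)
import Data.Sum as Sum
open import Data.Sum.Properties using (inj₁-injective; inj₂-injective)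
open import Data.Sum.Relation.Binary.Pointwise using (inj₁; inj₂)
open import Data.Unit using (tt; ⊤)
open import Data.Vec using (Vec; []; _∷_; lookup; tabulate; there; zipWith)
import Data.Vec.Functional as Table
open import Data.Vec.Properties using (lookup∘tabulate)
import Data.Vec.Properties as Vec
open import Function using (_∘_; id; _⇔_; mk⇔; Inverse; Equivalence; Injective; mk⤖; mk↣)
open import Function.Properties.Bijection using (⤖⇒↔)
open import Induction.WellFounded using (Acc; acc)
open import Level using (0ℓ)
open import Relation.Binary using (DecidableEquality; Rel)
open import Relation.Binary.PropositionalEquality using (_≡_; _≢_; refl; sym; trans; cong; subst; subst₂)
open import Relation.Nullary using (¬_; Dec; yes; no; does; contradiction)
open import Relation.Nullary.Decidable
  using (_×-dec_; _⊎-dec_; _→-dec_; map′; toWitness; fromWitness; ⌊_⌋; ¬?; dec-true; dec-false; does-⇔; decidable-stable)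
open import Relation.Unary using (Pred; Decidable; _∪_)

open Graph
open LabelledGraph

-- Closing a finite set under derivation steps

split : ∀ {A : Set} {P : A → Set} {R : List A} → Any P R →
        ∃₂ λ a R′ → P a × length R′ < length R × (∀ {b} → b ∈ R → b ≡ a ⊎ b ∈ R′)
split {R = a ∷ R} (here pa) = a , R , pa , ℕ.≤-refl , λ { (here e) → inj₁ e ; (there m) → inj₂ m }
split {R = c ∷ R} (there p) with split p
... | a , R′ , pa , lt , cover =
  a , c ∷ R′ , pa , s≤s lt ,
  λ { (here e) → inj₂ (here e) ; (there m) → Sum.map₂ there (cover m) }

-- `closed` drives the induction by which every construction leaves its trace among `members`, and
-- `sound` gives the converse, so a finite list can be searched in place of the infinitely many
-- expressions.
record Saturated {A : Set} (Derivable : List A → A → Set) (Sound : A → Set) : Set where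
  field
    members : List A
    closed  : ∀ a → Derivable members a → a ∈ members
    sound   : ∀ {a} → a ∈ members → Sound a

-- Each element is in `L`, already derived, or in `R`, still waiting. A round moves one derivable
-- element from `R` to `L`, which shortens `R`; when nothing in `R` is derivable from `L`, then `L`
-- is closed.
saturate : ∀ {A : Set} {Derivable : List A → A → Set} {Sound : A → Set} →
           (∀ L a → Dec (Derivable L a)) →
           (∀ L → (∀ {a} → a ∈ L → Sound a) → ∀ {a} → Derivable L a → Sound a) →
           (universe : List A) → (∀ a → a ∈ universe) → Saturated Derivable Sound
saturate {A} {Derivable} {Sound} derivable? preserves universe enumerates =
  go universe (<-wellFounded _) [] (λ a → inj₂ (enumerates a)) λ ()
  where
  move : ∀ {L R R′ : List A} {a b} → (b ∈ R → b ≡ a ⊎ b ∈ R′) → b ∈ L ⊎ b ∈ R → b ∈ a ∷ L ⊎ b ∈ R′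
  move cover (inj₁ b∈L) = inj₁ (there b∈L)
  move cover (inj₂ b∈R) = Sum.map₁ here (cover b∈R)
  go : (R : List A) → Acc _<_ (length R) → (L : List A) →
       (∀ a → a ∈ L ⊎ a ∈ R) → (∀ {a} → a ∈ L → Sound a) → Saturated Derivable Sound
  go R (acc rec) L cover sound with Any.any? (derivable? L) R
  ... | yes d with split d
  ...   | a , R′ , da , lt , cover′ =
    go R′ (rec lt) (a ∷ L)
       (λ b → move cover′ (cover b))
       λ { (here refl) → preserves L sound da ; (there m) → sound m }
  go R (acc rec) L cover sound | no ¬d = record
    { members = L
    ; closed  = λ a da → [ id , (λ m → contradiction (lose m da) ¬d) ]′ (cover a)
    ; sound   = sound
    }

any∈? : ∀ {A : Set} {P : A → Set} → Decidable P → ∀ (L : List A) → Dec (∃ λ a → a ∈ L × P a)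
any∈? P? L = map′ find (λ (a , m , p) → lose m p) (Any.any? P? L)

vectors : ∀ {A : Set} → List A → ∀ n → List (Vec A n)
vectors as zero    = [] ∷ []
vectors as (suc n) = cartesianProductWith _∷_ as (vectors as n)

∈-vectors : ∀ {A : Set} {as : List A} → (∀ a → a ∈ as) → ∀ {n} (v : Vec A n) → v ∈ vectors as n
∈-vectors all []      = here refl
∈-vectors all (a ∷ v) = ∈-cartesianProductWith⁺ _∷_ (all a) (∈-vectors all v)

bools : List Bool
bools = true ∷ false ∷ []

∈-bools : ∀ b → b ∈ bools
∈-bools true  = here refl
∈-bools false = there (here refl)

maybes : ∀ k → List (Maybe (Fin k))
maybes k = nothing ∷ List.map just (List.allFin k)

∈-maybes : ∀ {k} (m : Maybe (Fin k)) → m ∈ maybes k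
∈-maybes nothing  = here refl
∈-maybes (just i) = there (∈-map⁺ just (∈-allFin i))

if-just : ∀ {P : Set} {A : Set} (P? : Dec P) {a b : A} → (if does P? then just a else nothing) ≡ just b → P
if-just (yes p) _ = p

if-yes : ∀ {P : Set} {A : Set} (P? : Dec P) {a b : A} → P → (if does P? then a else b) ≡ a
if-yes (yes _) p = refl
if-yes (no ¬p) p = contradiction p ¬p

<∣>-just : ∀ {A : Set} (x y : Maybe A) {a} → (x <∣> y) ≡ just a → x ≡ just a ⊎ y ≡ just a
<∣>-just (just _) y e = inj₁ e
<∣>-just nothing  y e = inj₂ e

map-just : ∀ {A B : Set} {f : A → B} (x : Maybe A) {b} → Maybe.map f x ≡ just b → ∃ λ a → x ≡ just a
map-just (just a) _ = a , refl

module _ {k : ℕ} {G : Graph} where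

  assemble : (e : Expr k) (φ : Vertexˡ ⟦ e ⟧ → Vertex G) → Injective _≡_ _≡_ φ → (∀ v → ∃ λ u → φ u ≡ v) →
             (∀ u w → Adjˡ ⟦ e ⟧ u w ⇔ Adj G (φ u) (φ w)) → ConstructibleWith k G
  assemble e φ inj onto adj =
    e , ⤖⇒↔ (mk⤖ {to = φ} (inj , λ v → proj₁ (onto v) , λ { refl → proj₂ (onto v) })) , adj

-- Deciding whether k labels suffice

-- A state records a stage of a construction on the vertices Fin n: the labels of
-- the vertices created so far, and the edges drawn so far.
State : ℕ → ℕ → Set
State k n = Vec (Maybe (Fin k)) n × Vec (Vec Bool n) n

module _ {k n : ℕ} where

  labelAt : State k n → Fin n → Maybe (Fin k)
  labelAt s = lookup (proj₁ s)

  edge : State k n → Fin n → Fin n → Bool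
  edge s v w = lookup (lookup (proj₂ s) v) w

  state : (Fin n → Maybe (Fin k)) → (Fin n → Fin n → Bool) → State k n
  state l m = tabulate l , tabulate (tabulate ∘ m)

  labelAt-state : ∀ l m v → labelAt (state l m) v ≡ l v
  labelAt-state l m = lookup∘tabulate l

  edge-state : ∀ l m v w → edge (state l m) v w ≡ m v w
  edge-state l m v w =
    trans (cong (λ r → lookup r w) (lookup∘tabulate (tabulate ∘ m) v)) (lookup∘tabulate (m v) w)

  vertexS : Fin n → Fin k → State k n
  vertexS v i = state (λ w → if does (v ≟ w) then just i else nothing) (λ _ _ → false)

  unionS : State k n → State k n → State k n
  unionS s t = state (λ v → labelAt s v <∣> labelAt t v) (λ v w → edge s v w ∨ edge t v w)

  hasLabel? : (s : State k n) (i : Fin k) (v : Fin n) → Dec (labelAt s v ≡ just i)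
  hasLabel? s i v = Maybe.≡-dec _≟_ (labelAt s v) (just i)

  joins? : (s : State k n) (i j : Fin k) (v w : Fin n) →
           Dec (labelAt s v ≡ just i × labelAt s w ≡ just j ⊎ labelAt s v ≡ just j × labelAt s w ≡ just i)
  joins? s i j v w = (hasLabel? s i v ×-dec hasLabel? s j w) ⊎-dec (hasLabel? s j v ×-dec hasLabel? s i w)

  joinS : Fin k → Fin k → State k n → State k n
  joinS i j s = state (labelAt s) (λ v w → edge s v w ∨ ⌊ joins? s i j v w ⌋)

  relabelS : Fin k → Fin k → State k n → State k n
  relabelS i j s = state (λ v → Maybe.map (λ l → if does (l ≟ i) then j else l) (labelAt s v)) (edge s)

  trace : (e : Expr k) → (Vertexˡ ⟦ e ⟧ → Fin n) → State k n
  trace (vertex i)     φ = vertexS (φ tt) i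
  trace (e ⊕ f)        φ = unionS (trace e (φ ∘ inj₁)) (trace f (φ ∘ inj₂))
  trace (join i j _ e) φ = joinS i j (trace e φ)
  trace (relabel i j e) φ = relabelS i j (trace e φ)

  record Depicts (X : LabelledGraph k) (φ : Vertexˡ X → Fin n) (s : State k n) : Set where
    field
      labelled : ∀ u → labelAt s (φ u) ≡ just (label X u)
      image    : ∀ {v i} → labelAt s v ≡ just i → ∃ λ u → φ u ≡ v
      drawn    : ∀ {u w} → Adjˡ X u w → T (edge s (φ u) (φ w))
      genuine  : ∀ {v w} → T (edge s v w) → ∃₂ λ u u′ → φ u ≡ v × φ u′ ≡ w × Adjˡ X u u′

  open Depicts

  depicts-trace : ∀ e φ → Injective _≡_ _≡_ φ → Depicts ⟦ e ⟧ φ (trace e φ)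
  depicts-trace (vertex i) φ inj = record
    { labelled = λ _ → trans (labelAt-state l m (φ tt)) (if-yes (φ tt ≟ φ tt) refl)
    ; image    = λ {v} eq → tt , if-just (φ tt ≟ v) (trans (sym (labelAt-state l m v)) eq)
    ; drawn    = λ ()
    ; genuine  = λ {v} {w} t → ⊥-elim (subst T (edge-state l m v w) t)
    }
    where
    l = λ w → if does (φ tt ≟ w) then just i else nothing
    m = λ _ _ → false
  depicts-trace (e ⊕ f) φ inj = record
    { labelled = λ { (inj₁ u) → trans (at (φ (inj₁ u))) (cong (_<∣> _) (labelled De u))
                   ; (inj₂ u) → trans (at (φ (inj₂ u))) (trans (cong (_<∣> _) (outside u)) (labelled Df u)) }
    ; image    = λ {v} eq → [ (λ e → let (u , p) = image De e in inj₁ u , p)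
                            , (λ e → let (u , p) = image Df e in inj₂ u , p) ]′
                              (<∣>-just (labelAt s v) (labelAt t v) (trans (sym (at v)) eq))
    ; drawn    = λ { {u} {w} (inj₁ a) → to∨ (φ u) (φ w) (inj₁ (drawn De a))
                   ; {u} {w} (inj₂ a) → to∨ (φ u) (φ w) (inj₂ (drawn Df a)) }
    ; genuine  = λ {v} {w} b →
                   [ (λ b → let (u , u′ , p , q , a) = genuine De b in inj₁ u , inj₁ u′ , p , q , inj₁ a)
                   , (λ b → let (u , u′ , p , q , a) = genuine Df b in inj₂ u , inj₂ u′ , p , q , inj₂ a) ]′
                   (Equivalence.to T-∨ (subst T (ed v w) b))
    }
    where
    s = trace e (φ ∘ inj₁)
    t = trace f (φ ∘ inj₂)
    De = depicts-trace e (φ ∘ inj₁) (inj₁-injective ∘ inj)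
    Df = depicts-trace f (φ ∘ inj₂) (inj₂-injective ∘ inj)
    at = labelAt-state (λ v → labelAt s v <∣> labelAt t v) (λ v w → edge s v w ∨ edge t v w)
    ed = edge-state (λ v → labelAt s v <∣> labelAt t v) (λ v w → edge s v w ∨ edge t v w)
    to∨ : ∀ v w → T (edge s v w) ⊎ T (edge t v w) → T (edge (unionS s t) v w)
    to∨ v w p = subst T (sym (ed v w)) (Equivalence.from T-∨ p)
    -- `unionS` prefers the labels of its first argument; injectivity of `φ` ensures that this
    -- argument has none on the image of the second.
    outside : ∀ u → labelAt s (φ (inj₂ u)) ≡ nothing
    outside u with labelAt s (φ (inj₂ u)) in eq
    ... | nothing = refl
    ... | just _  with image De eq
    ...   | u′ , p with inj p
    ...     | ()
  depicts-trace (join i j i≢j e) φ inj = record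
    { labelled = λ u → trans (at (φ u)) (labelled De u)
    ; image    = λ {v} eq → image De (trans (sym (at v)) eq)
    ; drawn    = λ { {u} {w} (inj₁ a) → to∨ (φ u) (φ w) (inj₁ (drawn De a))
                   ; {u} {w} (inj₂ a) → to∨ (φ u) (φ w) (inj₂ (fromWitness (Sum.map (at-labels u w) (at-labels u w) a))) }
    ; genuine  = λ {v} {w} b →
                   [ (λ b → let (u , u′ , p , q , a) = genuine De b in u , u′ , p , q , inj₁ a)
                   , (λ b → [ (λ (p , q) → let (u , a , x) = locate p ; (u′ , a′ , x′) = locate q
                                           in u , u′ , a , a′ , inj₂ (inj₁ (x , x′)))
                            , (λ (p , q) → let (u , a , x) = locate p ; (u′ , a′ , x′) = locate q
                                           in u , u′ , a , a′ , inj₂ (inj₂ (x , x′))) ]′ (toWitness b)) ]′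
                   (Equivalence.to T-∨ (subst T (ed v w) b))
    }
    where
    s = trace e φ
    De = depicts-trace e φ inj
    m = λ v w → edge s v w ∨ ⌊ joins? s i j v w ⌋
    at = labelAt-state (labelAt s) m
    ed = edge-state (labelAt s) m
    to∨ : ∀ v w → T (edge s v w) ⊎ T ⌊ joins? s i j v w ⌋ → T (edge (joinS i j s) v w)
    to∨ v w p = subst T (sym (ed v w)) (Equivalence.from T-∨ p)
    at-labels : ∀ u w {i j} → label ⟦ e ⟧ u ≡ i × label ⟦ e ⟧ w ≡ j →
                labelAt s (φ u) ≡ just i × labelAt s (φ w) ≡ just j
    at-labels u w (refl , refl) = labelled De u , labelled De w
    locate : ∀ {v l} → labelAt s v ≡ just l → ∃ λ u → φ u ≡ v × label ⟦ e ⟧ u ≡ l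
    locate p with image De p
    ... | u , refl = u , refl , Maybe.just-injective (trans (sym (labelled De u)) p)
  depicts-trace (relabel i j e) φ inj = record
    { labelled = λ u → trans (at (φ u)) (cong (Maybe.map _) (labelled De u))
    ; image    = λ {v} eq → image De (proj₂ (map-just (labelAt s v) (trans (sym (at v)) eq)))
    ; drawn    = λ {u} {w} a → subst T (sym (ed (φ u) (φ w))) (drawn De a)
    ; genuine  = λ {v} {w} b → genuine De (subst T (ed v w) b)
    }
    where
    s = trace e φ
    De = depicts-trace e φ inj
    l = λ v → Maybe.map (λ l → if does (l ≟ i) then j else l) (labelAt s v)
    at = labelAt-state l (edge s)
    ed = edge-state l (edge s)

  Disjoint : State k n → State k n → Set
  Disjoint s t = ∀ v → labelAt s v ≡ nothing ⊎ labelAt t v ≡ nothing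

  -- `union` asks for disjoint states, since otherwise the combined placement of the two expressions
  -- would not be injective.
  data Derivable (L : List (State k n)) : State k n → Set where
    vertex  : ∀ v i → Derivable L (vertexS v i)
    union   : ∀ {s t} → s ∈ L → t ∈ L → Disjoint s t → Derivable L (unionS s t)
    join    : ∀ {s} i j → i ≢ j → s ∈ L → Derivable L (joinS i j s)
    relabel : ∀ {s} i j → s ∈ L → Derivable L (relabelS i j s)

  _≟ₛ_ : DecidableEquality (State k n)
  _≟ₛ_ = Product.≡-dec (Vec.≡-dec (Maybe.≡-dec _≟_)) (Vec.≡-dec (Vec.≡-dec Bool._≟_))

  derivable? : ∀ L a → Dec (Derivable L a)
  derivable? L a = map′
    [ (λ { (v , i , refl) → vertex v i })
    , [ (λ { (s , m , t , m′ , d , refl) → union m m′ d })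
      , [ (λ { (i , j , i≢j , s , m , refl) → join i j i≢j m })
        , (λ { (i , j , s , m , refl) → relabel i j m }) ]′ ]′ ]′
    (λ { (vertex v i)       → inj₁ (v , i , refl)
       ; (union m m′ d)     → inj₂ (inj₁ (_ , m , _ , m′ , d , refl))
       ; (join i j i≢j m)   → inj₂ (inj₂ (inj₁ (i , j , i≢j , _ , m , refl)))
       ; (relabel i j m)    → inj₂ (inj₂ (inj₂ (i , j , _ , m , refl))) })
    ( any? (λ v → any? λ i → a ≟ₛ vertexS v i)
      ⊎-dec any∈? (λ s → any∈? (λ t →
              all? (λ v → nothing? (labelAt s v) ⊎-dec nothing? (labelAt t v)) ×-dec a ≟ₛ unionS s t) L) L
      ⊎-dec any? (λ i → any? λ j → ¬? (i ≟ j) ×-dec any∈? (λ s → a ≟ₛ joinS i j s) L)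
      ⊎-dec any? (λ i → any? λ j → any∈? (λ s → a ≟ₛ relabelS i j s) L))
    where
    nothing? : (x : Maybe (Fin k)) → Dec (x ≡ nothing)
    nothing? x = Maybe.≡-dec _≟_ x nothing

  IsTrace : State k n → Set
  IsTrace s = ∃₂ λ e φ → Injective _≡_ _≡_ φ × s ≡ trace e φ

  derivable-isTrace : ∀ L → (∀ {s} → s ∈ L → IsTrace s) → ∀ {s} → Derivable L s → IsTrace s
  derivable-isTrace L ok (vertex v i) = vertex i , (λ _ → v) , (λ _ → refl) , refl
  derivable-isTrace L ok (join i j i≢j m) with ok m
  ... | e , φ , inj , refl = join i j i≢j e , φ , inj , refl
  derivable-isTrace L ok (relabel i j m) with ok m
  ... | e , φ , inj , refl = relabel i j e , φ , inj , refl
  derivable-isTrace L ok (union m m′ disjoint) with ok m | ok m′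
  ... | e , φ , inj , refl | f , ψ , inj′ , refl = e ⊕ f , [ φ , ψ ]′ , both , refl
    where
    apart : ∀ u w → φ u ≢ ψ w
    apart u w eq with disjoint (φ u)
    ... | inj₁ none with trans (sym none) (labelled (depicts-trace e φ inj) u)
    ...   | ()
    apart u w eq | inj₂ none
      with trans (sym none) (trans (cong (labelAt (trace f ψ)) eq) (labelled (depicts-trace f ψ inj′) w))
    ...   | ()
    both : Injective _≡_ _≡_ [ φ , ψ ]′
    both {inj₁ _} {inj₁ _} eq = cong inj₁ (inj eq)
    both {inj₂ _} {inj₂ _} eq = cong inj₂ (inj′ eq)
    both {inj₁ u} {inj₂ w} eq = contradiction eq (apart u w)
    both {inj₂ u} {inj₁ w} eq = contradiction (sym eq) (apart w u)

  saturatedStates : Saturated Derivable IsTrace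
  saturatedStates = saturate derivable? derivable-isTrace
    (cartesianProduct (vectors (maybes k) n) (vectors (vectors bools n) n))
    (λ (l , m) → ∈-cartesianProduct⁺ (∈-vectors ∈-maybes l) (∈-vectors (∈-vectors ∈-bools) m))

  open Saturated saturatedStates

  trace∈members : ∀ e φ → Injective _≡_ _≡_ φ → trace e φ ∈ members
  trace∈members (vertex i) φ inj = closed _ (vertex (φ tt) i)
  trace∈members (join i j i≢j e) φ inj = closed _ (join i j i≢j (trace∈members e φ inj))
  trace∈members (relabel i j e) φ inj = closed _ (relabel i j (trace∈members e φ inj))
  trace∈members (e ⊕ f) φ inj =
    closed _ (union (trace∈members e (φ ∘ inj₁) inj-e) (trace∈members f (φ ∘ inj₂) inj-f) disjoint)
    where
    inj-e : Injective _≡_ _≡_ (φ ∘ inj₁)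
    inj-e = inj₁-injective ∘ inj
    inj-f : Injective _≡_ _≡_ (φ ∘ inj₂)
    inj-f = inj₂-injective ∘ inj
    disjoint : Disjoint (trace e (φ ∘ inj₁)) (trace f (φ ∘ inj₂))
    disjoint v with labelAt (trace e (φ ∘ inj₁)) v in eq | labelAt (trace f (φ ∘ inj₂)) v in eq′
    ... | nothing | _       = inj₁ refl
    ... | just _  | nothing = inj₂ refl
    ... | just _  | just _
      with image (depicts-trace e (φ ∘ inj₁) inj-e) eq | image (depicts-trace f (φ ∘ inj₂) inj-f) eq′
    ...   | u , p | w , q with inj (trans p (sym q))
    ...     | ()

module _ (k : ℕ) (G : Graph) where

  Complete : State k (order G) → Set
  Complete s = (∀ v → ∃ λ i → labelAt s v ≡ just i)
             × (∀ v w → (T (edge s v w) → Adj G v w) × (Adj G v w → T (edge s v w)))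

  complete? : Decidable Complete
  complete? s =
    all? (λ v → any? λ i → hasLabel? s i v)
    ×-dec all? (λ v → all? λ w → (T? (edge s v w) →-dec adj? G v w) ×-dec (adj? G v w →-dec T? (edge s v w)))

  open Saturated (saturatedStates {k} {order G})
  open Depicts

  -- The trace of an expression for `G` is a complete member, and a complete member is the trace of
  -- an expression that builds `G`, so a search through `members` decides.
  constructible? : Dec (ConstructibleWith k G)
  constructible? = map′ build unbuild (any∈? complete? members)
    where
    build : ∃ (λ s → s ∈ members × Complete s) → ConstructibleWith k G
    build (s , m , total , edges) with sound m
    ... | e , φ , inj , refl = assemble {G = G} e φ inj
            (λ v → image D (proj₂ (total v)))
            λ u w → mk⇔ (λ a → proj₁ (edges (φ u) (φ w)) (drawn D a))
                        (λ a → subst-adj (genuine D (proj₂ (edges (φ u) (φ w)) a)))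
      where
      D = depicts-trace e φ inj
      subst-adj : ∀ {u w} → ∃₂ (λ u₁ w₁ → φ u₁ ≡ φ u × φ w₁ ≡ φ w × Adjˡ ⟦ e ⟧ u₁ w₁) → Adjˡ ⟦ e ⟧ u w
      subst-adj (_ , _ , p , q , a) = subst₂ (Adjˡ ⟦ e ⟧) (inj p) (inj q) a
    unbuild : ConstructibleWith k G → ∃ (λ s → s ∈ members × Complete s)
    unbuild (e , f , adj) = trace e φ , trace∈members e φ inj , total , edges
      where
      φ = Inverse.to f
      inj : Injective _≡_ _≡_ φ
      inj p = trans (sym (Inverse.strictlyInverseʳ f _)) (trans (cong (Inverse.from f) p) (Inverse.strictlyInverseʳ f _))
      D = depicts-trace e φ inj
      φ⁻¹ = Inverse.from f
      φφ⁻¹ = Inverse.strictlyInverseˡ f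
      total : ∀ v → ∃ λ i → labelAt (trace e φ) v ≡ just i
      total v = label ⟦ e ⟧ (φ⁻¹ v) ,
        subst (λ z → labelAt (trace e φ) z ≡ just (label ⟦ e ⟧ (φ⁻¹ v))) (φφ⁻¹ v) (labelled D (φ⁻¹ v))
      edges : ∀ v w → (T (edge (trace e φ) v w) → Adj G v w) × (Adj G v w → T (edge (trace e φ) v w))
      edges v w = (λ t → adjacent (genuine D t))
                , λ a → subst₂ (λ x y → T (edge (trace e φ) x y)) (φφ⁻¹ v) (φφ⁻¹ w)
                          (drawn D (Equivalence.from (adj _ _) (subst₂ (Adj G) (sym (φφ⁻¹ v)) (sym (φφ⁻¹ w)) a)))
        where
        adjacent : ∃₂ (λ u u′ → φ u ≡ v × φ u′ ≡ w × Adjˡ ⟦ e ⟧ u u′) → Adj G v w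
        adjacent (u , u′ , refl , refl , a) = Equivalence.to (adj u u′) a

least : ∀ {P : ℕ → Set} → Decidable P → ∀ {n} → P n → ∃ λ m → (P m × (∀ k → P k → m ≤ k)) × m ≤ n
least {P} P? {n} = go n (<-wellFounded n)
  where
  go : ∀ n → Acc _<_ n → P n → ∃ λ m → (P m × (∀ k → P k → m ≤ k)) × m ≤ n
  go n (acc rec) pn with ℕ.anyUpTo? P? n
  ... | no none = n , (pn , λ k pk → ℕ.≮⇒≥ λ k<n → none (k , k<n , pk)) , ℕ.≤-refl
  ... | yes (m , m<n , pm) with go m (rec m<n) pm
  ...   | l , minimal , l≤m = l , minimal , ℕ.≤-trans l≤m (ℕ.<⇒≤ m<n)

constructible⇒cliqueWidth≤ : ∀ {G k} → ConstructibleWith k G → CliqueWidth≤ G k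
constructible⇒cliqueWidth≤ {G} = least (λ k → constructible? k G)

-- Constructions that add one vertex at a time

module _ {V : Set} {k : ℕ} where

  -- `R` and `ℓ` matter only on `S`, so each stage of a construction can be described by a relation
  -- and a labelling on all of `V`; `redescribe` changes them off `S` at will.
  record Drawing (S : Pred V 0ℓ) (R : Rel V 0ℓ) (ℓ : V → Fin k) : Set where
    field
      expr      : Expr k
      place     : Vertexˡ ⟦ expr ⟧ → V
      injective : Injective _≡_ _≡_ place
      inside    : ∀ u → S (place u)
      onto      : ∀ {v} → S v → ∃ λ u → place u ≡ v
      labelled  : ∀ u → label ⟦ expr ⟧ u ≡ ℓ (place u)
      adjacent  : ∀ u w → Adjˡ ⟦ expr ⟧ u w ⇔ R (place u) (place w)

  open Drawing

  redescribe : ∀ {S S′ : Pred V 0ℓ} {R R′ : Rel V 0ℓ} {ℓ ℓ′ : V → Fin k} →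
               (∀ {v} → S v → S′ v) → (∀ {v} → S′ v → S v) →
               (∀ {v w} → S v → S w → (R v w → R′ v w) × (R′ v w → R v w)) →
               (∀ {v} → S v → ℓ v ≡ ℓ′ v) →
               Drawing S R ℓ → Drawing S′ R′ ℓ′
  redescribe S⊆S′ S′⊆S R⇔R′ ℓ≗ℓ′ D = record
    { expr      = expr D
    ; place     = place D
    ; injective = injective D
    ; inside    = S⊆S′ ∘ inside D
    ; onto      = onto D ∘ S′⊆S
    ; labelled  = λ u → trans (labelled D u) (ℓ≗ℓ′ (inside D u))
    ; adjacent  = λ u w → mk⇔ (proj₁ (R⇔R′ (inside D u) (inside D w)) ∘ Equivalence.to (adjacent D u w))
                              (Equivalence.from (adjacent D u w) ∘ proj₂ (R⇔R′ (inside D u) (inside D w)))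
    }

  drawVertex : ∀ (ℓ : V → Fin k) v → Drawing (_≡ v) (λ _ _ → ⊥) ℓ
  drawVertex ℓ v = record
    { expr      = vertex (ℓ v)
    ; place     = λ _ → v
    ; injective = λ _ → refl
    ; inside    = λ _ → refl
    ; onto      = λ e → tt , sym e
    ; labelled  = λ _ → refl
    ; adjacent  = λ _ _ → mk⇔ id id
    }

  Joined : (V → Fin k) → (i j : Fin k) → Rel V 0ℓ
  Joined ℓ i j v w = (ℓ v ≡ i × ℓ w ≡ j) ⊎ (ℓ v ≡ j × ℓ w ≡ i)

  drawJoin : ∀ {S R ℓ} i j → i ≢ j → Drawing S R ℓ → Drawing S (λ v w → R v w ⊎ Joined ℓ i j v w) ℓ
  drawJoin {ℓ = ℓ} i j i≢j D = record
    { expr      = join i j i≢j (expr D)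
    ; place     = place D
    ; injective = injective D
    ; inside    = inside D
    ; onto      = onto D
    ; labelled  = labelled D
    ; adjacent  = λ u w → mk⇔
        (Sum.map (Equivalence.to (adjacent D u w)) (Sum.map (to u w) (to u w)))
        (Sum.map (Equivalence.from (adjacent D u w)) (Sum.map (from u w) (from u w)))
    }
    where
    to : ∀ u w {a b} → label ⟦ expr D ⟧ u ≡ a × label ⟦ expr D ⟧ w ≡ b → ℓ (place D u) ≡ a × ℓ (place D w) ≡ b
    to u w (p , q) = trans (sym (labelled D u)) p , trans (sym (labelled D w)) q
    from : ∀ u w {a b} → ℓ (place D u) ≡ a × ℓ (place D w) ≡ b → label ⟦ expr D ⟧ u ≡ a × label ⟦ expr D ⟧ w ≡ b
    from u w (p , q) = trans (labelled D u) p , trans (labelled D w) q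

  drawRelabel : ∀ {S R ℓ} i j → Drawing S R ℓ → Drawing S R (λ v → if does (ℓ v ≟ i) then j else ℓ v)
  drawRelabel i j D = record
    { expr      = relabel i j (expr D)
    ; place     = place D
    ; injective = injective D
    ; inside    = inside D
    ; onto      = onto D
    ; labelled  = λ u → cong (λ l → if does (l ≟ i) then j else l) (labelled D u)
    ; adjacent  = adjacent D
    }

  drawUnion : ∀ {S S′ R R′ ℓ} → (∀ {v} → S v → ¬ S′ v) → Drawing S R ℓ → Drawing S′ R′ ℓ →
              Drawing (S ∪ S′) (λ v w → (S v × S w × R v w) ⊎ (S′ v × S′ w × R′ v w)) ℓ
  drawUnion {S} {S′} {R} {R′} disjoint D D′ = record
    { expr      = expr D ⊕ expr D′
    ; place     = φ
    ; injective = λ {u} {w} → inj {u} {w}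
    ; inside    = λ { (inj₁ u) → inj₁ (inside D u) ; (inj₂ u) → inj₂ (inside D′ u) }
    ; onto      = λ { (inj₁ s) → let (u , e) = onto D s in inj₁ u , e
                    ; (inj₂ s) → let (u , e) = onto D′ s in inj₂ u , e }
    ; labelled  = λ { (inj₁ u) → labelled D u ; (inj₂ u) → labelled D′ u }
    ; adjacent  = λ u w → mk⇔ (to u w) (from u w)
    }
    where
    φ = [ place D , place D′ ]′
    inj : Injective _≡_ _≡_ φ
    inj {inj₁ _} {inj₁ _} e = cong inj₁ (injective D e)
    inj {inj₂ _} {inj₂ _} e = cong inj₂ (injective D′ e)
    inj {inj₁ u} {inj₂ w} e = contradiction (inside D′ w) (disjoint (subst S e (inside D u)))
    inj {inj₂ u} {inj₁ w} e = contradiction (inside D′ u) (disjoint (subst S (sym e) (inside D w)))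
    Union = λ v w → (S v × S w × R v w) ⊎ (S′ v × S′ w × R′ v w)
    to : ∀ u w → Adjˡ ⟦ expr D ⊕ expr D′ ⟧ u w → Union (φ u) (φ w)
    to _ _ (inj₁ {u} {w} a) = inj₁ (inside D u , inside D w , Equivalence.to (adjacent D u w) a)
    to _ _ (inj₂ {u} {w} a) = inj₂ (inside D′ u , inside D′ w , Equivalence.to (adjacent D′ u w) a)
    from : ∀ u w → Union (φ u) (φ w) → Adjˡ ⟦ expr D ⊕ expr D′ ⟧ u w
    from (inj₁ u) (inj₁ w) (inj₁ (_ , _ , a)) = inj₁ (Equivalence.from (adjacent D u w) a)
    from (inj₂ u) (inj₂ w) (inj₂ (_ , _ , a)) = inj₂ (Equivalence.from (adjacent D′ u w) a)
    from (inj₁ u) _        (inj₂ (s , _ , _)) = contradiction s (disjoint (inside D u))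
    from (inj₂ u) _        (inj₁ (s , _ , _)) = contradiction (inside D′ u) (disjoint s)
    from _        (inj₁ w) (inj₂ (_ , s , _)) = contradiction s (disjoint (inside D w))
    from _        (inj₂ w) (inj₁ (_ , s , _)) = contradiction (inside D′ w) (disjoint s)

module _ {V : Set} {m : ℕ} {S : Pred V 0ℓ} {ℓ : V → Fin (suc m)} where

  joinedTo : List (Fin m) → Rel V 0ℓ
  joinedTo js v w = Any (λ j → Joined ℓ zero (suc j) v w) js

  drawJoins : ∀ {R} (js : List (Fin m)) → Drawing S R ℓ → Drawing S (λ v w → R v w ⊎ joinedTo js v w) ℓ
  drawJoins []       D = redescribe id id (λ _ _ → inj₁ , λ { (inj₁ r) → r }) (λ _ → refl) D
  drawJoins (j ∷ js) D = redescribe id id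
    (λ _ _ → (λ { (inj₁ (inj₁ r)) → inj₁ r ; (inj₁ (inj₂ p)) → inj₂ (there p) ; (inj₂ p) → inj₂ (here p) })
           , (λ { (inj₁ r) → inj₁ (inj₁ r) ; (inj₂ (here p)) → inj₂ p ; (inj₂ (there p)) → inj₁ (inj₂ p) }))
    (λ _ → refl) (drawJoin zero (suc j) (λ ()) (drawJoins js D))

x∉p-x : ∀ {n} (p : Subset n) x → ¬ x ∈ˢ (p - x)
x∉p-x (_ ∷ p) zero    ()
x∉p-x (_ ∷ p) (suc x) (there x∈p-x) = x∉p-x p x x∈p-x

module _ (G : Graph) {m : ℕ} (lab : Vertex G → Fin m) where

  -- This is what allows `x` to be attached to the rest of `S` by joins between whole labels.
  Removable : Subset (order G) → Vertex G → Set
  Removable S x = ∀ {u u′} → u ∈ˢ S → u′ ∈ˢ S → u ≢ x → u′ ≢ x → lab u ≡ lab u′ → Adj G x u → Adj G x u′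

  Drawn : Pred (Vertex G) 0ℓ → Set
  Drawn S = Drawing {k = suc m} S (Adj G) (λ v → suc (lab v))

  -- Label zero is reserved for the vertex x that is being inserted.
  insert : ∀ {S : Pred (Vertex G) 0ℓ} → (∀ v → Dec (S v)) → ∀ x → ¬ S x →
           (∀ {u u′} → S u → S u′ → lab u ≡ lab u′ → Adj G x u → Adj G x u′) →
           Drawn S → Drawn (S ∪ (_≡ x))
  insert {S} S? x x∉S uniform D =
    redescribe id id (λ p q → to p q , from p q) final (drawRelabel zero (suc (lab x)) (drawJoins js
      (drawUnion (λ { s refl → x∉S s }) (redescribe id id (λ _ _ → id , id) old D) (drawVertex ℓ x))))
    where
    ℓ : Vertex G → Fin (suc m)
    ℓ v = if does (v ≟ x) then zero else suc (lab v)

    ℓ-x : ∀ {v} → v ≡ x → ℓ v ≡ zero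
    ℓ-x {v} e with v ≟ x
    ... | yes _ = refl
    ... | no ¬e = contradiction e ¬e

    old : ∀ {v} → S v → suc (lab v) ≡ ℓ v
    old {v} s with v ≟ x
    ... | yes refl = contradiction s x∉S
    ... | no _     = refl

    final : ∀ {v} → (S ∪ (_≡ x)) v → (if does (ℓ v ≟ zero) then suc (lab x) else ℓ v) ≡ suc (lab v)
    final {v} _ with v ≟ x
    ... | yes refl = refl
    ... | no _     = refl

    Meets : Fin m → Set
    Meets j = ∃ λ u → S u × lab u ≡ j × Adj G x u

    meets? : ∀ j → Dec (Meets j)
    meets? j = any? λ u → S? u ×-dec lab u ≟ j ×-dec adj? G x u

    -- By `uniform`, one neighbour of `x` with a given label forces all vertices of `S` with that
    -- label to be neighbours, so joining `x` to these labels adds only edges of `G`.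
    js : List (Fin m)
    js = filter meets? (allFin m)

    R : Rel (Vertex G) 0ℓ
    R v w = ((S v × S w × Adj G v w) ⊎ (v ≡ x × w ≡ x × ⊥)) ⊎ joinedTo {S = S} {ℓ = ℓ} js v w

    is-x : ∀ {v} → (S ∪ (_≡ x)) v → ℓ v ≡ zero → v ≡ x
    is-x (inj₂ e) _ = e
    is-x (inj₁ s) e with trans (old s) e
    ... | ()

    is-old : ∀ {v j} → (S ∪ (_≡ x)) v → ℓ v ≡ suc j → S v × lab v ≡ j
    is-old (inj₁ s) e = s , suc-injective (trans (old s) e)
    is-old (inj₂ v≡x) e with trans (sym (ℓ-x v≡x)) e
    ... | ()

    star : ∀ {v w j} → Meets j → (S ∪ (_≡ x)) v → (S ∪ (_≡ x)) w → ℓ v ≡ zero → ℓ w ≡ suc j → Adj G v w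
    star (u , s , eq , a) p q e e′ with is-x p e | is-old q e′
    ... | refl | s′ , refl = uniform s s′ eq a

    to : ∀ {v w} → (S ∪ (_≡ x)) v → (S ∪ (_≡ x)) w → R v w → Adj G v w
    to p q (inj₁ (inj₁ (_ , _ , a))) = a
    to p q (inj₂ joined) with find joined
    ... | j , j∈js , inj₁ (e , e′) = star (proj₂ (∈-filter⁻ meets? {xs = allFin m} j∈js)) p q e e′
    ... | j , j∈js , inj₂ (e , e′) = symm G (star (proj₂ (∈-filter⁻ meets? {xs = allFin m} j∈js)) q p e′ e)

    meet : ∀ {u} → S u → Adj G x u → Any (λ j → ℓ x ≡ zero × ℓ u ≡ suc j) js
    meet {u} s a = lose (∈-filter⁺ meets? (∈-allFin (lab u)) (u , s , refl , a)) (ℓ-x refl , sym (old s))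

    from : ∀ {v w} → (S ∪ (_≡ x)) v → (S ∪ (_≡ x)) w → Adj G v w → R v w
    from (inj₁ s)    (inj₁ t)    a = inj₁ (inj₁ (s , t , a))
    from (inj₂ refl) (inj₁ t)    a = inj₂ (Any.map inj₁ (meet t a))
    from (inj₁ s)    (inj₂ refl) a =
      inj₂ (Any.map (λ (e , e′) → inj₂ (e′ , e)) (meet s (symm G a)))
    from (inj₂ refl) (inj₂ refl) a = contradiction a (irrefl G refl)

  module _ (removable : ∀ S → Nonempty S → ∃ λ x → x ∈ˢ S × Removable S x) where

    draw : ∀ S → Acc _<_ ∣ S ∣ → Nonempty S → Drawn (_∈ˢ S)
    draw S (acc rec) ne with removable S ne
    ... | x , x∈S , uniform with nonempty? (S - x)
    -- No expression denotes the empty graph, so the recursion ends at a single vertex.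
    ...   | no empty = redescribe (λ { refl → x∈S }) only
                         (λ { refl refl → (λ ()) , λ a → irrefl G refl a }) (λ _ → refl)
                         (drawVertex (λ v → suc (lab v)) x)
      where
      only : ∀ {v} → v ∈ˢ S → v ≡ x
      only {v} v∈S with v ≟ x
      ... | yes e = e
      ... | no ¬e = contradiction (v , x∈p∧x≢y⇒x∈p-y v∈S ¬e) empty
    ...   | yes ne′ = redescribe [ p─q⊆p S _ , (λ { refl → x∈S }) ]′ classify (λ _ _ → id , id) (λ _ → refl)
                        (insert (_∈? (S - x)) x x∉
                          (λ p q → uniform (p─q⊆p S _ p) (p─q⊆p S _ q) (λ { refl → x∉ p }) (λ { refl → x∉ q }))
                          (draw (S - x) (rec (x∈p⇒∣p-x∣<∣p∣ x∈S)) ne′))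
      where
      x∉ : ¬ x ∈ˢ (S - x)
      x∉ = x∉p-x S x
      classify : ∀ {v} → v ∈ˢ S → (v ∈ˢ (S - x)) ⊎ v ≡ x
      classify {v} v∈S with v ≟ x
      ... | yes e = inj₂ e
      ... | no ¬e = inj₁ (x∈p∧x≢y⇒x∈p-y v∈S ¬e)

    linearConstruction : Vertex G → ConstructibleWith (suc m) G
    linearConstruction x = assemble {G = G} expr place injective (λ v → onto {v} ∈⊤) adjacent
      where open Drawing (draw full (<-wellFounded _) (x , ∈⊤))

-- Checking small graphs for forbidden subgraphs by evaluation

-- The search is Boolean-valued, and not a composite of decision procedures, because it is
-- run by the type checker on several hundred graphs.
Matrix : ℕ → Set
Matrix n = Vec (Vec Bool n) n

-- The added vertex gets index zero.
_▹_ : ∀ {n} → Matrix n → Vec Bool n → Matrix (suc n)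
m ▹ r = (false ∷ r) ∷ zipWith _∷_ r m

infixl 5 _▹_

entry : ∀ {n} → Matrix n → Fin n → Fin n → Bool
entry m a b = lookup (lookup m a) b

_≡ᵇ_ : Bool → Bool → Bool
true  ≡ᵇ b = b
false ≡ᵇ b = not b

≡ᵇ⇒≡ : ∀ a b → T (a ≡ᵇ b) → a ≡ b
≡ᵇ⇒≡ true  true  _ = refl
≡ᵇ⇒≡ false false _ = refl

some : ∀ {n} → (Fin n → Bool) → Bool
some {zero}  f = false
some {suc n} f = f zero ∨ some (f ∘ suc)

some⇒∃ : ∀ {n} (f : Fin n → Bool) → T (some f) → ∃ λ i → T (f i)
some⇒∃ {suc n} f t =
  [ zero ,_ , (λ t → let (i , p) = some⇒∃ (f ∘ suc) t in suc i , p) ]′ (Equivalence.to (T-∨ {f zero}) t)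

differ : ∀ {n} → Vec Bool n → Vec Bool n → Bool
differ []       []       = false
differ (a ∷ as) (b ∷ bs) = not (a ≡ᵇ b) ∨ differ as bs

differ⇒≢ : ∀ {n} (v w : Vec Bool n) → T (differ v w) → v ≢ w
differ⇒≢ (true  ∷ v) _ t refl = differ⇒≢ v v t refl
differ⇒≢ (false ∷ v) _ t refl = differ⇒≢ v v t refl

table : (H : Graph) → Matrix (order H)
table H = tabulate λ u → tabulate λ v → does (adj? H u v)

entry-table : ∀ H u v → entry (table H) u v ≡ does (adj? H u v)
entry-table H u v = trans (cong (λ r → lookup r v) (lookup∘tabulate _ u)) (lookup∘tabulate _ v)

module Search {k n : ℕ} (h : Matrix k) (m : Matrix n) where

  -- Vertices are told apart by their rows and not by their indices, so that a matrix may
  -- list the same vertex of G twice; this is how v_i can be treated as a vertex of A_i.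
  fits : Fin k → Fin n → List (Fin k × Fin n) → Bool
  fits u a []             = true
  fits u a ((v , b) ∷ ps) =
    (entry h u v ≡ᵇ entry m a b) ∧ differ (lookup m a) (lookup m b) ∧ fits u a ps

  extends : List (Fin k) → List (Fin k × Fin n) → Bool
  extends []       ps = true
  extends (u ∷ us) ps = some λ a → fits u a ps ∧ extends us ((u , a) ∷ ps)

  Compatible : Fin k × Fin n → Fin k × Fin n → Set
  Compatible (u , a) (v , b) = entry h u v ≡ entry m a b × lookup m a ≢ lookup m b

  fits⇒ : ∀ u a ps → T (fits u a ps) → All (Compatible (u , a)) ps
  fits⇒ u a []             t = []
  fits⇒ u a ((v , b) ∷ ps) t with Equivalence.to (T-∧ {entry h u v ≡ᵇ entry m a b}) t
  ... | e , t′ with Equivalence.to (T-∧ {differ (lookup m a) (lookup m b)}) t′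
  ...   | d , t″ = (≡ᵇ⇒≡ _ _ e , differ⇒≢ _ _ d) ∷ fits⇒ u a ps t″

  -- The partial placement grows by one vertex of the pattern at a time, and `fits` compares the new
  -- vertex with all earlier ones.
  placements : ∀ us ps → AllPairs Compatible ps → T (extends us ps) →
               ∃ λ qs → AllPairs Compatible qs × (∀ {p} → p ∈ ps → p ∈ qs) × (∀ {u} → u ∈ us → ∃ λ a → (u , a) ∈ qs)
  placements []       ps ok _ = ps , ok , id , λ ()
  placements (u ∷ us) ps ok t with some⇒∃ _ t
  ... | a , t′ with Equivalence.to (T-∧ {fits u a ps}) t′
  ...   | f , t″ with placements us ((u , a) ∷ ps) (fits⇒ u a ps f ∷ ok) t″
  ...     | qs , ok′ , old , new =
    qs , ok′ , old ∘ there , λ { (here refl) → a , old (here refl) ; (there u∈us) → new u∈us }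

occurs : ∀ {k n} → Matrix k → Matrix n → Bool
occurs {k} h m = Search.extends h m (allFin k) []

forbidden : ∀ {n} → Matrix n → Bool
forbidden m = occurs (table (C 4)) m ∨ occurs (table (4 K₁)) m ∨ occurs (table (P 6)) m

-- A record, so that the type checker does not unfold the search on symbolic matrices.
record Forbidden {n : ℕ} (m : Matrix n) : Set where
  constructor found
  field evidence : T (forbidden m)

forbidden? : ∀ {n} (m : Matrix n) → Dec (Forbidden m)
forbidden? m = map′ found Forbidden.evidence (T? (forbidden m))

does-sym : (G : Graph) → ∀ x y → does (adj? G x y) ≡ does (adj? G y x)
does-sym G x y with adj? G x y | adj? G y x
... | yes _ | yes _ = refl
... | no _  | no _  = refl
... | yes a | no ¬a = contradiction (symm G a) ¬a
... | no ¬a | yes a = contradiction (symm G a) ¬a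

module _ (G : Graph) where

  adjacent : Vertex G → Vertex G → Bool
  adjacent x y = does (adj? G x y)

  record Describes {n} (m : Matrix n) (g : Fin n → Vertex G) : Set where
    constructor describes
    field agree : ∀ a b → adjacent (g a) (g b) ≡ entry m a b

  open Describes

  module _ {n} {m : Matrix n} {g : Fin n → Vertex G} (desc : Describes m g) where

    describes-▹ : ∀ r x → (∀ b → adjacent x (g b) ≡ lookup r b) → Describes (m ▹ r) (x Table.∷ g)
    describes-▹ r x row = describes λ where
      zero    zero    → dec-false (adj? G x x) (irrefl G refl)
      zero    (suc b) → row b
      (suc a) zero    → trans (does-sym G (g a) x) (trans (row a)
        (cong (λ w → lookup w zero) (sym (Vec.lookup-zipWith _∷_ a r m))))
      (suc a) (suc b) → trans (agree desc a b)
        (cong (λ w → lookup w (suc b)) (sym (Vec.lookup-zipWith _∷_ a r m)))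

    -- A row lists the adjacencies of its vertex to the vertices `g c`, so equal vertices have equal
    -- rows.
    row≢⇒≢ : ∀ {a b} → lookup m a ≢ lookup m b → g a ≢ g b
    row≢⇒≢ {a} {b} rows≢ eq = rows≢
      (trans (sym (Vec.tabulate∘lookup _)) (trans (Vec.tabulate-cong λ c →
        trans (sym (agree desc a c)) (trans (cong (λ v → adjacent v (g c)) eq) (agree desc b c))) (Vec.tabulate∘lookup _)))

    module _ (H : Graph) where

      open Search (table H) m

      compatible-sym : ∀ {p q} → Compatible p q → Compatible q p
      compatible-sym {u , a} {v , b} (eq , d) =
        trans (entry-table H v u) (trans (does-sym H v u) (trans (sym (entry-table H u v)) (trans eq
          (trans (sym (agree desc a b)) (trans (does-sym G (g a) (g b)) (agree desc b a)))))) , d ∘ sym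

      pairwise : ∀ {qs} → AllPairs Compatible qs → ∀ {p q} → p ∈ qs → q ∈ qs → p ≡ q ⊎ Compatible p q
      pairwise (_ ∷ _)  (here refl) (here refl) = inj₁ refl
      pairwise (c ∷ _)  (here refl) (there q)   = inj₂ (All.lookup c q)
      pairwise (c ∷ _)  (there p)   (here refl) = inj₂ (compatible-sym (All.lookup c p))
      pairwise (_ ∷ ok) (there p)   (there q)   = pairwise ok p q

      occurs⇒⊑ : T (occurs (table H) m) → H ⊑ G
      occurs⇒⊑ occ with placements (allFin (order H)) [] [] occ
      ... | qs , ok , _ , placed = mk↣ {to = f} inj , λ u v → adj u v
        where
        index : Vertex H → Fin n
        index u = proj₁ (placed (∈-allFin u))
        f : Vertex H → Vertex G
        f = g ∘ index
        compat : ∀ u v → u ≡ v ⊎ Compatible (u , index u) (v , index v)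
        compat u v = [ inj₁ ∘ cong proj₁ , inj₂ ]′ (pairwise ok (proj₂ (placed (∈-allFin u))) (proj₂ (placed (∈-allFin v))))
        inj : ∀ {u v} → f u ≡ f v → u ≡ v
        inj {u} {v} eq = [ id , (λ (_ , d) → contradiction eq (row≢⇒≢ d)) ]′ (compat u v)
        adj : ∀ u v → Adj H u v ⇔ Adj G (f u) (f v)
        adj u v with compat u v
        ... | inj₁ refl = mk⇔ (λ a → contradiction a (irrefl H refl)) (λ a → contradiction a (irrefl G refl))
        ... | inj₂ (eq , _) with trans (sym (entry-table H u v)) (trans eq (sym (agree desc (index u) (index v))))
        ...   | eq′ with adj? H u v | adj? G (f u) (f v)
        ...     | yes a | yes b = mk⇔ (λ _ → b) (λ _ → a)
        ...     | no ¬a | no ¬b = mk⇔ (λ a → contradiction a ¬a) (λ b → contradiction b ¬b)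

  forbidden-free : (4 K₁ ∷ C 4 ∷ P 6 ∷ []) -Free G → ∀ {n} {m : Matrix n} {g} → Describes m g → ¬ Forbidden m
  forbidden-free (no-4K₁ ∷ no-C₄ ∷ no-P₆ ∷ []) {m = m} desc (found t) with Equivalence.to (T-∨ {occurs (table (C 4)) m}) t
  ... | inj₁ c₄ = no-C₄ (occurs⇒⊑ {m = m} desc (C 4) c₄)
  ... | inj₂ t′ with Equivalence.to (T-∨ {occurs (table (4 K₁)) m}) t′
  ...   | inj₁ 4k₁ = no-4K₁ (occurs⇒⊑ {m = m} desc (4 K₁) 4k₁)
  ...   | inj₂ p₆  = no-P₆ (occurs⇒⊑ {m = m} desc (P 6) p₆)

-- The vertices of G relative to an induced C₆

Kind : Set
Kind = Fin 4

pattern A = zero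
pattern B = suc zero
pattern D = suc (suc zero)
pattern F = suc (suc (suc zero))

∀-bool? : ∀ {Q : Bool → Set} → Decidable Q → Dec (∀ b → Q b)
∀-bool? Q? = map′ (λ { (t , f) → λ { true → t ; false → f } }) (λ q → q true , q false) (Q? true ×-dec Q? false)

∃-bool? : ∀ {Q : Bool → Set} → Decidable Q → Dec (∃ Q)
∃-bool? Q? = map′ [ true ,_ , false ,_ ]′ (λ { (true , q) → inj₁ q ; (false , q) → inj₂ q }) (Q? true ⊎-dec Q? false)

∀-vec? : ∀ {n} {Q : Vec Bool n → Set} → Decidable Q → Dec (∀ v → Q v)
∀-vec? {zero}  Q? = map′ (λ { q [] → q }) (λ q → q []) (Q? [])
∀-vec? {suc n} Q? = map′ (λ { q (b ∷ v) → q b v }) (λ q b v → q (b ∷ v)) (∀-bool? λ b → ∀-vec? λ v → Q? (b ∷ v))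

infixl 9 _⊞_ _⊟_

-- Opaque, since the type checker would unfold mod on symbolic arguments.
opaque
  _⊟_ _⊞_ : Fin 6 → Fin 6 → Fin 6
  j ⊟ i = (toℕ j + (6 ∸ toℕ i)) mod 6
  j ⊞ i = (toℕ j + toℕ i) mod 6

-- The neighbours v_j of a vertex of class i are listed by j ⊟ i.  The flag of a vertex of A_i
-- tells whether it is adjacent to v_i, that is, whether it differs from v_i.
shape : Kind → Bool → Vec Bool 6
shape A s = s    ∷ true  ∷ false ∷ false ∷ false ∷ true  ∷ []
shape B s = true ∷ true  ∷ true  ∷ true  ∷ false ∷ false ∷ []
shape D s = true ∷ false ∷ false ∷ true  ∷ false ∷ false ∷ []
shape F s = true ∷ true  ∷ true  ∷ true  ∷ true  ∷ true  ∷ []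

row : Kind → Fin 6 → Bool → Vec Bool 6
row k i s = tabulate λ j → lookup (shape k s) (j ⊟ i)

cycle : Matrix 6
cycle = table (C 6)

data Verdict : Set where
  complete anticomplete mixed impossible : Verdict

-- The relation between class i of the first kind and class j of the second kind, by j ⊟ i.
verdicts : Kind → Kind → Vec Verdict 6
verdicts A A = complete ∷ complete ∷ mixed ∷ anticomplete ∷ mixed ∷ complete ∷ []
verdicts A B = mixed ∷ anticomplete ∷ anticomplete ∷ mixed ∷ complete ∷ complete ∷ []
verdicts B A = mixed ∷ complete ∷ complete ∷ mixed ∷ anticomplete ∷ anticomplete ∷ []
verdicts B B = complete ∷ complete ∷ anticomplete ∷ complete ∷ anticomplete ∷ complete ∷ []
verdicts D D = complete ∷ impossible ∷ impossible ∷ complete ∷ impossible ∷ impossible ∷ []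
verdicts F _ = complete ∷ complete ∷ complete ∷ complete ∷ complete ∷ complete ∷ []
verdicts _ F = complete ∷ complete ∷ complete ∷ complete ∷ complete ∷ complete ∷ []
-- Only `D` against `A` or `B` is left. The period three reflects that opposite indices give the
-- same row of kind `D`.
verdicts _ _ = complete ∷ anticomplete ∷ anticomplete ∷ complete ∷ anticomplete ∷ anticomplete ∷ []

verdict : Kind → Kind → Fin 6 → Verdict
verdict k l d = lookup (verdicts k l) d

Obeys : Verdict → Bool → Set
Obeys complete     b = T b
Obeys anticomplete b = T (not b)
Obeys mixed        b = ⊤
Obeys impossible   b = ⊥

obeys? : ∀ v b → Dec (Obeys v b)
obeys? complete     b = T? b
obeys? anticomplete b = T? (not b)
obeys? mixed        b = yes tt
obeys? impossible   b = no id

isMixed : Verdict → Bool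
isMixed mixed = true
isMixed _     = false

even meets : Fin 6 → Bool
even d  = does (d ≟ # 2) ∨ does (d ≟ # 4)
meets d = does (d ≟ # 0) ∨ does (d ≟ # 3)

_⇒_ : Bool → Bool → Bool
a ⇒ b = not a ∨ b

opaque
  unfolding _⊟_ _⊞_

  -- Evaluation over all 64 rows. The cycle vertices are covered too: the row of v_i is
  -- `row A i false`.
  classification : ∀ r → (∃ λ k → ∃ λ i → ∃ λ s → r ≡ row k i s) ⊎ Forbidden (cycle ▹ r)
  classification = toWitness {a? = ∀-vec? λ r →
    (any? λ k → any? λ i → ∃-bool? λ s → Vec.≡-dec Bool._≟_ r (row k i s)) ⊎-dec forbidden? (cycle ▹ r)} tt

  -- Vertices with the same row may coincide, so their adjacency cannot be settled here.
  pairs : ∀ k l d t s b → row k zero s ≡ row l d t ⊎ Obeys (verdict k l d) b ⊎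
                          Forbidden (cycle ▹ row k zero s ▹ (b ∷ row l d t))
  pairs = toWitness {a? = all? λ k → all? λ l → all? λ d → ∀-bool? λ t → ∀-bool? λ s → ∀-bool? λ b →
    Vec.≡-dec Bool._≟_ (row k zero s) (row l d t) ⊎-dec obeys? (verdict k l d) b ⊎-dec
    forbidden? (cycle ▹ row k zero s ▹ (b ∷ row l d t))} tt

  -- Distinct vertices with equal rows turn out to be adjacent; this reconciles that outcome with
  -- the verdict in the case that `pairs` leaves open.
  twins-complete : ∀ k l d t s → row k zero s ≡ row l d t → Obeys (verdict k l d) true
  twins-complete = toWitness {a? = all? λ k → all? λ l → all? λ d → ∀-bool? λ t → ∀-bool? λ s →
    Vec.≡-dec Bool._≟_ (row k zero s) (row l d t) →-dec obeys? (verdict k l d) true} tt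

  -- Two distinct nonadjacent vertices with this row would close an induced C₄ with v_p and v_q.
  poles : ∀ k s → ∃₂ λ p q → p ≢ q × entry cycle p q ≡ false ×
                             lookup (row k zero s) p ≡ true × lookup (row k zero s) q ≡ true
  poles = toWitness {a? = all? λ k → ∀-bool? λ s → any? λ p → any? λ q → ¬? (p ≟ q) ×-dec (entry cycle p q Bool.≟ false)
    ×-dec (lookup (row k zero s) p Bool.≟ true) ×-dec (lookup (row k zero s) q Bool.≟ true)} tt

-- The first vertex has class zero, and P is a condition on the classes d and e of the others;
-- this suffices since the cycle can be rotated.
module Triples (k l m : Kind) (P : Fin 6 → Fin 6 → Bool) (Q : Bool → Bool → Bool → Bool) where

  -- The newest vertex has index zero, hence `b₂₃` comes before `b₁₃`.
  configuration : Fin 6 → Fin 6 → (b₁₂ b₁₃ b₂₃ s t u : Bool) → Matrix 9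
  configuration d e b₁₂ b₁₃ b₂₃ s t u = cycle ▹ row k zero s ▹ (b₁₂ ∷ row l d t) ▹ (b₂₃ ∷ b₁₃ ∷ row m e u)

  Forced : Set
  Forced = ∀ d e → T (P d e) → ∀ b₁₂ b₁₃ b₂₃ → T (Q b₁₂ b₁₃ b₂₃) ⊎
           (∀ s t u → Forbidden (configuration d e b₁₂ b₁₃ b₂₃ s t u))

  forced? : Dec Forced
  forced? = all? λ d → all? λ e → T? (P d e) →-dec
    (∀-bool? λ b₁₂ → ∀-bool? λ b₁₃ → ∀-bool? λ b₂₃ → T? (Q b₁₂ b₁₃ b₂₃) ⊎-dec
    (∀-bool? λ s → ∀-bool? λ t → ∀-bool? λ u → forbidden? (configuration d e b₁₂ b₁₃ b₂₃ s t u)))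

open Triples using (Forced; forced?)

opaque
  unfolding _⊟_ _⊞_

  -- Otherwise the three vertices form an induced C₄ with the cycle vertex between the classes of
  -- the first and the third, which the second does not see.
  forced-AAA : Forced A A A (λ d e → even d ∧ even e ∧ not (does (d ≟ e))) (λ b₁₂ b₁₃ b₂₃ → b₁₂ ⇒ (b₂₃ ⇒ b₁₃))
  forced-AAA = toWitness {a? = forced? A A A _ _} tt

  -- Let x in A₀, y and z be the three vertices. If only y sees z, then x, y, z, v₀ is an induced
  -- C₄; if only x sees z, then x, y, v₃, z is one.
  forced-AAB : Forced A A B (λ d e → even d ∧ meets e) (λ b₁₂ b₁₃ b₂₃ → b₁₂ ⇒ (b₁₃ ≡ᵇ b₂₃))
  forced-AAB = toWitness {a? = forced? A A B _ _} tt

  -- For x in A₀ and y in A₃, a vertex z of B₀ that misses both starts the induced P₆ z, v₁, x, v₅,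
  -- v₄, y, unless x and y are adjacent, when x, y, v₄, v₅ is an induced C₄. The case of B₃ is
  -- symmetric.
  forced-AAB′ : Forced A A B (λ d e → does (d ≟ # 3) ∧ meets e) (λ _ b₁₃ b₂₃ → b₁₃ ∨ b₂₃)
  forced-AAB′ = toWitness {a? = forced? A A B _ _} tt

  -- For x in A₀, y in B₀ and z in B₃, where y and z are adjacent because of v₀ and v₃, the vertices
  -- x, y, z, v₅ would otherwise form an induced C₄. With B₀ and B₃ exchanged, v₁ replaces v₅.
  forced-ABB : Forced A B B (λ d e → meets d ∧ meets e ∧ not (does (d ≟ e))) (λ b₁₂ b₁₃ _ → b₁₂ ⇒ b₁₃)
  forced-ABB = toWitness {a? = forced? A B B _ _} tt

-- Boolean adjacency and induced squares

module _ (G : Graph) where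

  open Describes

  adjacent-true : ∀ {x y} → Adj G x y → adjacent G x y ≡ true
  adjacent-true {x} {y} = dec-true (adj? G x y)

  adjacent-false : ∀ {x y} → ¬ Adj G x y → adjacent G x y ≡ false
  adjacent-false {x} {y} = dec-false (adj? G x y)

  adjacent⇒ : ∀ {x y} → T (adjacent G x y) → Adj G x y
  adjacent⇒ {x} {y} t with adj? G x y
  ... | yes a = a

  ⇒adjacent : ∀ {x y} → Adj G x y → T (adjacent G x y)
  ⇒adjacent a = subst T (sym (adjacent-true a)) tt

  ¬adjacent⇒ : ∀ {x y} → T (not (adjacent G x y)) → ¬ Adj G x y
  ¬adjacent⇒ {x} {y} t with adj? G x y
  ... | no ¬a = ¬a

  describes⇒⊑ : ∀ {H : Graph} {g : Vertex H → Vertex G} → Injective _≡_ _≡_ g → Describes G (table H) g → H ⊑ G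
  describes⇒⊑ {H} {g} inj desc = mk↣ inj , λ u v → mk⇔
    (λ a → adjacent⇒ (subst T (sym (trans (agree desc u v) (entry-table H u v)))
                               (subst T (sym (dec-true (adj? H u v) a)) tt)))
    (λ a → does⇒ u v (subst T (trans (agree desc u v) (entry-table H u v)) (⇒adjacent a)))
    where
    does⇒ : ∀ u v → T (does (adj? H u v)) → Adj H u v
    does⇒ u v t with adj? H u v
    ... | yes a = a

  no-square : ¬ (C 4 ⊑ G) → ∀ {a b c d} → Adj G a b → Adj G b c → Adj G c d → Adj G d a →
              ¬ Adj G a c → ¬ Adj G b d → a ≢ c → b ≢ d → ⊥
  no-square no-C₄ {a} {b} {c} {d} ab bc cd da ¬ac ¬bd a≢c b≢d = no-C₄ (describes⇒⊑ {C 4} inj desc)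
    where
    g : Fin 4 → Vertex G
    g = d Table.∷ c Table.∷ b Table.∷ a Table.∷ λ ()
    adj≢ : ∀ {x y} → Adj G x y → x ≢ y
    adj≢ xy refl = irrefl G refl xy
    inj : ∀ {u v} → g u ≡ g v → u ≡ v
    inj {zero}                  {zero}                  e = refl
    inj {zero}                  {suc zero}              e = contradiction (sym e) (adj≢ cd)
    inj {zero}                  {suc (suc zero)}        e = contradiction (sym e) b≢d
    inj {zero}                  {suc (suc (suc zero))}  e = contradiction e (adj≢ da)
    inj {suc zero}              {zero}                  e = contradiction e (adj≢ cd)
    inj {suc zero}              {suc zero}              e = refl
    inj {suc zero}              {suc (suc zero)}        e = contradiction (sym e) (adj≢ bc)
    inj {suc zero}              {suc (suc (suc zero))}  e = contradiction (sym e) a≢c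
    inj {suc (suc zero)}        {zero}                  e = contradiction e b≢d
    inj {suc (suc zero)}        {suc zero}              e = contradiction e (adj≢ bc)
    inj {suc (suc zero)}        {suc (suc zero)}        e = refl
    inj {suc (suc zero)}        {suc (suc (suc zero))}  e = contradiction (sym e) (adj≢ ab)
    inj {suc (suc (suc zero))}  {zero}                  e = contradiction (sym e) (adj≢ da)
    inj {suc (suc (suc zero))}  {suc zero}              e = contradiction e a≢c
    inj {suc (suc (suc zero))}  {suc (suc zero)}        e = contradiction e (adj≢ ab)
    inj {suc (suc (suc zero))}  {suc (suc (suc zero))}  e = refl
    desc : Describes G (table (C 4)) g
    desc = describes-▹ G (describes-▹ G (describes-▹ G (describes-▹ G (describes {m = []} {g = λ ()} λ ())
        [] a λ ())
        (true ∷ []) b λ { zero → adjacent-true (symm G ab) })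
        (true ∷ false ∷ []) c λ { zero → adjacent-true (symm G bc) ; (suc zero) → adjacent-false (¬ac ∘ symm G) })
        (true ∷ false ∷ true ∷ []) d
        λ { zero → adjacent-true (symm G cd) ; (suc zero) → adjacent-false (¬bd ∘ symm G)
          ; (suc (suc zero)) → adjacent-true da }

-- Rotations of the cycle and arithmetic of indices modulo 6

opaque
  unfolding _⊟_ _⊞_

  ⊟-self : ∀ i → i ⊟ i ≡ zero
  ⊟-self = toWitness {a? = all? λ i → i ⊟ i ≟ zero} tt

  ⊟-injective : ∀ i j m → j ⊟ i ≡ m ⊟ i → j ≡ m
  ⊟-injective = toWitness {a? = all? λ i → all? λ j → all? λ m → (j ⊟ i ≟ m ⊟ i) →-dec (j ≟ m)} tt

  ⊟≡⇒⊞ : ∀ i j d → j ⊟ i ≡ d → j ≡ i ⊞ d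
  ⊟≡⇒⊞ = toWitness {a? = all? λ i → all? λ j → all? λ d → (j ⊟ i ≟ d) →-dec (j ≟ i ⊞ d)} tt

  cycle-rotate : ∀ a p q → entry cycle (p ⊞ a) (q ⊞ a) ≡ entry cycle p q
  cycle-rotate = toWitness {a? = all? λ a → all? λ p → all? λ q → entry cycle (p ⊞ a) (q ⊞ a) Bool.≟ entry cycle p q} tt

  row-rotate : ∀ k i a s j → lookup (row k i s) (j ⊞ a) ≡ lookup (row k (i ⊟ a) s) j
  row-rotate = toWitness {a? = all? λ k → all? λ i → all? λ a → ∀-bool? λ s → all? λ j →
    lookup (row k i s) (j ⊞ a) Bool.≟ lookup (row k (i ⊟ a) s) j} tt

  cycle-injective : ∀ p q → (∀ j → entry cycle p j ≡ entry cycle q j) → p ≡ q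
  cycle-injective = toWitness {a? = all? λ p → all? λ q →
    all? (λ j → entry cycle p j Bool.≟ entry cycle q j) →-dec (p ≟ q)} tt

opposite : Fin 6 → Fin 6
opposite i = i ⊞ # 3

-- The three indices of one parity, in some order, written so as to unfold to the guard of
-- `forced-AAA`.
triad : Fin 6 → Fin 6 → Fin 6 → Bool
triad i j m = even (j ⊟ i) ∧ even (m ⊟ i) ∧ not (does (j ⊟ i ≟ m ⊟ i))

opaque
  unfolding _⊟_ _⊞_

  triad-rotate : ∀ i j m → T (triad i j m) → T (triad j m i)
  triad-rotate = toWitness {a? = all? λ i → all? λ j → all? λ m → T? (triad i j m) →-dec T? (triad j m i)} tt

  triad-swap : ∀ i j m → T (triad i j m) → T (triad i m j)
  triad-swap = toWitness {a? = all? λ i → all? λ j → all? λ m → T? (triad i j m) →-dec T? (triad i m j)} tt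

  triad⇒≢ : ∀ i j m → T (triad i j m) → j ≢ m
  triad⇒≢ i j .j t refl = toWitness {a? = all? λ i → all? λ j → ¬? (T? (triad i j j))} tt i j t

  mixed-cases : ∀ k l d → T (isMixed (verdict k l d)) →
                (k ≡ A × l ≡ A × T (even d)) ⊎ (k ≡ A × l ≡ B × T (meets d)) ⊎ (k ≡ B × l ≡ A × T (meets d))
  mixed-cases = toWitness {a? = all? λ k → all? λ l → all? λ d → T? (isMixed (verdict k l d)) →-dec
    (((k ≟ A) ×-dec (l ≟ A) ×-dec T? (even d)) ⊎-dec ((k ≟ A) ×-dec (l ≟ B) ×-dec T? (meets d)) ⊎-dec
     ((k ≟ B) ×-dec (l ≟ A) ×-dec T? (meets d)))} tt

self-complete : ∀ k p → Obeys (verdict k k zero) p → T p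
self-complete = toWitness {a? = all? λ k → ∀-bool? λ p → obeys? (verdict k k zero) p →-dec T? p} tt

_≡ᵛ_ : Verdict → Verdict → Bool
complete     ≡ᵛ complete     = true
anticomplete ≡ᵛ anticomplete = true
mixed        ≡ᵛ mixed        = true
impossible   ≡ᵛ impossible   = true
_            ≡ᵛ _            = false

≡ᵛ⇒≡ : ∀ v w → T (v ≡ᵛ w) → v ≡ w
≡ᵛ⇒≡ complete     complete     _ = refl
≡ᵛ⇒≡ anticomplete anticomplete _ = refl
≡ᵛ⇒≡ mixed        mixed        _ = refl
≡ᵛ⇒≡ impossible   impossible   _ = refl

opaque
  unfolding _⊟_ _⊞_

  -- The tag `onD` forgets the index, which is harmless because `D-meets` leaves only equal or
  -- opposite indices.
  D-period : ∀ k i j m → T (meets (m ⊟ j)) → verdict k D (j ⊟ i) ≡ verdict k D (m ⊟ i)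
  D-period k i j m t = ≡ᵛ⇒≡ _ _ (toWitness {a? = all? λ k → all? λ i → all? λ j → all? λ m →
    T? (meets (m ⊟ j)) →-dec T? (verdict k D (j ⊟ i) ≡ᵛ verdict k D (m ⊟ i))} tt k i j m t)

  -- The index of a vertex of kind `F` is an arbitrary choice, its row being the same for every
  -- index.
  F-period : ∀ k i j m → verdict k F (j ⊟ i) ≡ verdict k F (m ⊟ i)
  F-period k i j m = ≡ᵛ⇒≡ _ _ (toWitness {a? = all? λ k → all? λ i → all? λ j → all? λ m →
    T? (verdict k F (j ⊟ i) ≡ᵛ verdict k F (m ⊟ i))} tt k i j m)

  ⊞2≢ : ∀ i → i ⊞ # 2 ≢ i
  ⊞2≢ = toWitness {a? = all? λ i → ¬? (i ⊞ # 2 ≟ i)} tt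

  D-meets : ∀ d b → Obeys (verdict D D d) b → T (meets d)
  D-meets = toWitness {a? = all? λ d → ∀-bool? λ b → obeys? (verdict D D d) b →-dec T? (meets d)} tt

  ⊞2⊞4 : ∀ i → (i ⊞ # 2) ⊞ # 4 ≡ i
  ⊞2⊞4 = toWitness {a? = all? λ i → (i ⊞ # 2) ⊞ # 4 ≟ i} tt

  ⊞4⊞2 : ∀ i → (i ⊞ # 4) ⊞ # 2 ≡ i
  ⊞4⊞2 = toWitness {a? = all? λ i → (i ⊞ # 4) ⊞ # 2 ≟ i} tt

  ⊟-swap-24 : ∀ i j → T (even (j ⊟ i)) → (j ⊟ i ≡ # 2 × i ⊟ j ≡ # 4) ⊎ (j ⊟ i ≡ # 4 × i ⊟ j ≡ # 2)
  ⊟-swap-24 = toWitness {a? = all? λ i → all? λ j → T? (even (j ⊟ i)) →-dec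
    (((j ⊟ i ≟ # 2) ×-dec (i ⊟ j ≟ # 4)) ⊎-dec ((j ⊟ i ≟ # 4) ×-dec (i ⊟ j ≟ # 2)))} tt

  triad-22 : ∀ i j m → j ⊟ i ≡ # 2 → m ⊟ j ≡ # 2 → T (triad i j m)
  triad-22 = toWitness {a? = all? λ i → all? λ j → all? λ m →
    (j ⊟ i ≟ # 2) →-dec ((m ⊟ j ≟ # 2) →-dec T? (triad i j m))} tt

  -- A class B_m that is mixed on A_i is not mixed on A_{i±2}.
  even-meets : ∀ i j m → T (even (j ⊟ i)) → T (meets (m ⊟ i)) → ¬ T (isMixed (verdict A B (m ⊟ j)))
  even-meets = toWitness {a? = all? λ i → all? λ j → all? λ m →
    T? (even (j ⊟ i)) →-dec (T? (meets (m ⊟ i)) →-dec ¬? (T? (isMixed (verdict A B (m ⊟ j)))))} tt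

  meets-cases : ∀ i m → T (meets (m ⊟ i)) → i ≡ m ⊎ i ≡ opposite m
  meets-cases = toWitness {a? = all? λ i → all? λ m → T? (meets (m ⊟ i)) →-dec ((i ≟ m) ⊎-dec (i ≟ opposite m))} tt

  meets-sym : ∀ i m → T (meets (m ⊟ i)) → T (meets (i ⊟ m))
  meets-sym = toWitness {a? = all? λ i → all? λ m → T? (meets (m ⊟ i)) →-dec T? (meets (i ⊟ m))} tt

  meets-opposite : ∀ i m → i ≡ m ⊎ i ≡ opposite m → T (meets (m ⊟ i))
  meets-opposite = toWitness {a? = all? λ i → all? λ m → ((i ≟ m) ⊎-dec (i ≟ opposite m)) →-dec T? (meets (m ⊟ i))} tt

  AAB-guard : ∀ m → T (does (opposite m ⊟ m ≟ # 3) ∧ meets (m ⊟ m))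
  AAB-guard = toWitness {a? = all? λ m → T? (does (opposite m ⊟ m ≟ # 3) ∧ meets (m ⊟ m))} tt

  ABB-guard : ∀ i j m → T (meets (j ⊟ i)) → T (meets (m ⊟ i)) → j ≢ m →
              T (meets (j ⊟ i) ∧ meets (m ⊟ i) ∧ not (does (j ⊟ i ≟ m ⊟ i)))
  ABB-guard = toWitness {a? = all? λ i → all? λ j → all? λ m → T? (meets (j ⊟ i)) →-dec (T? (meets (m ⊟ i)) →-dec
    (¬? (j ≟ m) →-dec T? (meets (j ⊟ i) ∧ meets (m ⊟ i) ∧ not (does (j ⊟ i ≟ m ⊟ i)))))} tt

-- Signs, tags and extreme vertices of nested pairs

-- The sign of a vertex of A_i is up if it has a neighbour in A_{i+2}, otherwise down if it has
-- a neighbour in A_{i-2}, and otherwise none.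
Sign : Set
Sign = Fin 3

pattern none = zero
pattern up   = suc zero
pattern down = suc (suc zero)

data Tag : Set where
  onA     : Fin 6 → Sign → Tag
  onB     : Fin 6 → Tag
  onD onF : Tag

-- Six classes A_i with three signs take 18 codes, the B_i take six, `onD` and `onF` one each.
code : Tag → Fin 26
code (onA i s) = combine i s ↑ˡ 8
code (onB i)   = 18 ↑ʳ (i ↑ˡ 2)
code onD       = # 24
code onF       = # 25

decodeBDF : Fin 6 ⊎ Fin 2 → Tag
decodeBDF (inj₁ i)          = onB i
decodeBDF (inj₂ zero)       = onD
decodeBDF (inj₂ (suc zero)) = onF

decode : Fin 26 → Tag
decode = [ uncurry onA ∘ remQuot {6} 3 , decodeBDF ∘ splitAt 6 ]′ ∘ splitAt 18

decode-code : ∀ l → decode (code l) ≡ l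
decode-code (onA i s) = trans
  (cong [ uncurry onA ∘ remQuot {6} 3 , decodeBDF ∘ splitAt 6 ]′ (splitAt-↑ˡ 18 (combine i s) 8))
  (cong (uncurry onA) (remQuot-combine i s))
decode-code (onB i)   = cong decodeBDF (splitAt-↑ˡ 6 i 2)
decode-code onD       = refl
decode-code onF       = refl

code-injective : ∀ {l l′} → code l ≡ code l′ → l ≡ l′
code-injective {l} {l′} e = trans (sym (decode-code l)) (trans (cong decode e) (decode-code l′))

_≟ᵗ_ : (l l′ : Tag) → Dec (l ≡ l′)
l ≟ᵗ l′ = map′ code-injective (cong code) (code l ≟ code l′)

-- The only tag on which a vertex tagged onA i up or onA i down can be mixed.
partner : Tag → Tag
partner (onA i up)   = onA (i ⊞ # 2) down
partner (onA i down) = onA (i ⊞ # 4) up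
partner l            = l

-- The hypothesis on R says that the neighbourhoods of the vertices of X in Y are nested.
extremal : ∀ {n} {R : Fin n → Fin n → Set} {X Y : Fin n → Set} →
           (∀ x y → Dec (R x y)) → (∀ x → Dec (X x)) → (∀ y → Dec (Y y)) →
           (∀ {x x′ y y′} → X x → X x′ → Y y → Y y′ → R x y → R x′ y′ → R x y′ ⊎ R x′ y) →
           ∃ (λ v → X v ⊎ Y v) →
           (∃ λ x → X x × (∀ {y} → Y y → R x y)) ⊎ (∃ λ y → Y y × (∀ {x} → X x → ¬ R x y))
extremal {n} {R} {X} {Y} R? X? Y? nested inhabited with any? X?
... | no empty = inj₂ (fromY inhabited)
  where
  fromY : ∃ (λ v → X v ⊎ Y v) → ∃ λ y → Y y × (∀ {x} → X x → ¬ R x y)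
  fromY (v , inj₁ Xv) = contradiction (v , Xv) empty
  fromY (v , inj₂ Yv) = v , Yv , λ Xx _ → empty (_ , Xx)
... | yes (x₀ , Xx₀) = Sum.map₁ (λ (x , Xx , all) → x , Xx , λ {y} Yy → All.lookup all (∈-filter⁺ Y? (∈-allFin y) Yy))
                                (go (filter Y? (allFin n)) (all-filter Y? (allFin n)))
  where
  go : ∀ ys → All Y ys → (∃ λ x → X x × All (R x) ys) ⊎ (∃ λ y → Y y × (∀ {x} → X x → ¬ R x y))
  go []       []        = inj₁ (x₀ , Xx₀ , [])
  go (y ∷ ys) (Yy ∷ Yys) with go ys Yys
  ... | inj₂ r = inj₂ r
  ... | inj₁ (x , Xx , all) with R? x y | any? (λ x′ → X? x′ ×-dec R? x′ y)
  ...   | yes r | _              = inj₁ (x , Xx , r ∷ all)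
  ...   | no _  | no isolated    = inj₂ (y , Yy , λ Xx′ r → isolated (_ , Xx′ , r))
  -- `x` misses `y` while `x′` sees it, so by nestedness `x′` sees every vertex of `ys` that `x`
  -- sees.
  ...   | no ¬r | yes (x′ , Xx′ , r′) = inj₁ (x′ , Xx′ , r′ ∷ All.zipWith
            (λ (Yy′ , r) → [ (λ r → contradiction r ¬r) , id ]′ (nested Xx Xx′ Yy′ Yy r r′)) (Yys , all))

⇒-elim : ∀ p {q} → T (p ⇒ q) → T p → T q
⇒-elim true t _ = t

same-pure : ∀ v p q → ¬ T (isMixed v) → Obeys v p → Obeys v q → T p → T q
same-pure complete     _    _ _ _ o _ = o
same-pure anticomplete true _ _ () _ _
same-pure mixed        _    _ pure _ _ _ = contradiction tt pure

tagOf : Kind → Fin 6 → Sign → Tag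
tagOf A i s = onA i s
tagOf B i s = onB i
tagOf D i s = onD
tagOf F i s = onF

tagOf≡onA : ∀ k {i s j t} → tagOf k i s ≡ onA j t → k ≡ A × i ≡ j × s ≡ t
tagOf≡onA A refl = refl , refl , refl
tagOf≡onA B ()
tagOf≡onA D ()
tagOf≡onA F ()

tagOf≡onB : ∀ k {i s j} → tagOf k i s ≡ onB j → k ≡ B × i ≡ j
tagOf≡onB B refl = refl , refl
tagOf≡onB A ()
tagOf≡onB D ()
tagOf≡onB F ()

tagOf≡onD : ∀ k {i s} → tagOf k i s ≡ onD → k ≡ D
tagOf≡onD D refl = refl
tagOf≡onD A ()
tagOf≡onD B ()
tagOf≡onD F ()

tagOf≡onF : ∀ k {i s} → tagOf k i s ≡ onF → k ≡ F
tagOf≡onF F refl = refl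
tagOf≡onF A ()
tagOf≡onF B ()
tagOf≡onF D ()

module _ {P Q : Set} where

  signOf : Dec P → Dec Q → Sign
  signOf (yes _) _       = up
  signOf (no _)  (yes _) = down
  signOf (no _)  (no _)  = none

  signOf-up : (p? : Dec P) (q? : Dec Q) → P → signOf p? q? ≡ up
  signOf-up (yes _) _ _ = refl
  signOf-up (no ¬p) _ p = contradiction p ¬p

  signOf≡up : (p? : Dec P) (q? : Dec Q) → signOf p? q? ≡ up → P
  signOf≡up (yes p) _       _ = p
  signOf≡up (no _)  (yes _) ()
  signOf≡up (no _)  (no _)  ()

  signOf≡down : (p? : Dec P) (q? : Dec Q) → signOf p? q? ≡ down → Q
  signOf≡down (no _)  (yes q) _ = q
  signOf≡down (yes _) _       ()
  signOf≡down (no _)  (no _)  ()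

  signOf≢none : (p? : Dec P) (q? : Dec Q) → Q → signOf p? q? ≢ none
  signOf≢none (no _)  (no ¬q) q _ = ¬q q
  signOf≢none (yes _) _       _ ()
  signOf≢none (no _)  (yes _) _ ()

-- The classes of G and the edges between them

module _ (G : Graph) (free : (4 K₁ ∷ C 4 ∷ P 6 ∷ []) -Free G) where

  private
    V = Vertex G
    adjG = adjacent G

  open Describes

  square : ∀ {a b c d} → Adj G a b → Adj G b c → Adj G c d → Adj G d a →
           ¬ Adj G a c → ¬ Adj G b d → a ≢ c → b ≢ d → ⊥
  square = no-square G (All.lookup free (there (here refl)))

  record Member (c : Fin 6 → V) (x : V) (k : Kind) (i : Fin 6) : Set where
    constructor _,_
    field
      self   : Bool
      meetsᶜ : ∀ j → adjG x (c j) ≡ lookup (row k i self) j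

  -- The evaluated checks place the first vertex in class zero; rotating by its index brings it
  -- there.
  rotate : (Fin 6 → V) → Fin 6 → Fin 6 → V
  rotate c a j = c (j ⊞ a)

  rotate-member : ∀ c a {x k i} → Member c x k i → Member (rotate c a) x k (i ⊟ a)
  rotate-member c a {k = k} {i} (s , r) = s , λ j → trans (r (j ⊞ a)) (row-rotate k i a s j)

  rotate-member₀ : ∀ c i {x k} → Member c x k i → Member (rotate c i) x k zero
  rotate-member₀ c i {x} {k} m = subst (Member (rotate c i) x k) (⊟-self i) (rotate-member c i m)

  module _ {c : Fin 6 → V} (hexagon : Describes G cycle c) where

    opaque
      classify : ∀ x → ∃ λ k → ∃ λ i → Member c x k i
      classify x = [ (λ (k , i , s , eq) → k , i , (s , λ j → trans (sym (r-row j)) (cong (λ r → lookup r j) eq)))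
                   , (λ bad → contradiction bad (forbidden-free G free (describes-▹ G hexagon r x λ j → sym (r-row j)))) ]′
                   (classification r)
        where
        r : Vec Bool 6
        r = tabulate λ j → adjG x (c j)
        r-row : ∀ j → lookup r j ≡ adjG x (c j)
        r-row = lookup∘tabulate λ j → adjG x (c j)

    edge-to-cycle : ∀ r {x p} → (∀ j → adjG x (c j) ≡ lookup r j) → lookup r p ≡ true → Adj G x (c p)
    edge-to-cycle r {p = p} agrees e = adjacent⇒ G (subst T (sym (trans (agrees p) e)) tt)

    cycle-vertices-distinct : ∀ {p q} → c p ≡ c q → p ≡ q
    cycle-vertices-distinct {p} {q} e = cycle-injective p q λ j →
      trans (sym (agree hexagon p j)) (trans (cong (λ v → adjG v (c j)) e) (agree hexagon q j))

    -- Otherwise `x`, `c p`, `y`, `c q` would form an induced C₄.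
    twins-adjacent : ∀ r {x y p q} → x ≢ y → p ≢ q → entry cycle p q ≡ false → lookup r p ≡ true → lookup r q ≡ true →
                     (∀ j → adjG x (c j) ≡ lookup r j) → (∀ j → adjG y (c j) ≡ lookup r j) → Adj G x y
    twins-adjacent r {x} {y} {p} {q} x≢y p≢q ¬pq xp xq rx ry with adj? G x y
    ... | yes xy = xy
    ... | no ¬xy = ⊥-elim (square (edge-to-cycle r rx xp) (symm G (edge-to-cycle r ry xp))
                     (edge-to-cycle r ry xq) (symm G (edge-to-cycle r rx xq)) ¬xy
                     (¬adjacent⇒ G (subst (T ∘ not) (sym (trans (agree hexagon p q) ¬pq)) tt)) x≢y
                     (p≢q ∘ cycle-vertices-distinct))

    -- If the rows differ, `pairs` decides. If they agree, `x` and `y` are distinct twins, hence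
    -- adjacent, and `twins-complete` applies.
    obeys₀ : ∀ {x y k l d} → x ≢ y → Member c x k zero → Member c y l d → Obeys (verdict k l d) (adjG x y)
    obeys₀ {x} {y} {k} {l} {d} x≢y (s , r) (t , r′) =
      [ twins , [ subst (Obeys (verdict k l d)) (does-sym G y x) , (λ bad → contradiction bad good) ]′ ]′
      (pairs k l d t s (adjG y x))
      where
      good : ¬ Forbidden (cycle ▹ row k zero s ▹ (adjG y x ∷ row l d t))
      good = forbidden-free G free (describes-▹ G (describes-▹ G hexagon (row k zero s) x r)
        (adjG y x ∷ row l d t) y λ { zero → refl ; (suc j) → r′ j })
      twins : row k zero s ≡ row l d t → Obeys (verdict k l d) (adjG x y)
      twins eq =
        let (p , q , p≢q , ¬pq , xp , xq) = poles k s
            xy = twins-adjacent (row k zero s) x≢y p≢q ¬pq xp xq r (λ j → trans (r′ j) (cong (λ v → lookup v j) (sym eq)))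
        in subst (Obeys (verdict k l d)) (sym (adjacent-true G xy)) (twins-complete k l d t s eq)

    forced₀ : ∀ {k l m P Q x y z d e} → Triples.Forced k l m P Q → Member c x k zero → Member c y l d → Member c z m e →
              T (P d e) → T (Q (adjG x y) (adjG x z) (adjG y z))
    forced₀ {k} {l} {m} {x = x} {y} {z} {d} {e} forced (s , r) (t , r′) (u , r″) p =
      [ id , (λ bad → contradiction (bad s t u) good) ]′ (forced d e p (adjG x y) (adjG x z) (adjG y z))
      where
      good : ¬ Forbidden (cycle ▹ row k zero s ▹ (adjG x y ∷ row l d t) ▹ (adjG y z ∷ adjG x z ∷ row m e u))
      good = forbidden-free G free (describes-▹ G (describes-▹ G (describes-▹ G hexagon (row k zero s) x r)
        (adjG x y ∷ row l d t) y λ { zero → does-sym G y x ; (suc j) → r′ j })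
        (adjG y z ∷ adjG x z ∷ row m e u) z
        λ { zero → does-sym G z y ; (suc zero) → does-sym G z x ; (suc (suc j)) → r″ j })

  module _ {c : Fin 6 → V} (hexagon : Describes G cycle c) where

    rotate-hexagon : ∀ a → Describes G cycle (rotate c a)
    rotate-hexagon a = describes λ p q → trans (agree hexagon (p ⊞ a) (q ⊞ a)) (cycle-rotate a p q)

    kind : V → Kind
    kind x = proj₁ (classify hexagon x)

    index : V → Fin 6
    index x = proj₁ (proj₂ (classify hexagon x))

    member : ∀ x {k} → kind x ≡ k → Member c x k (index x)
    member x refl = proj₂ (proj₂ (classify hexagon x))

    δ : V → V → Fin 6
    δ x y = index y ⊟ index x

    obeys : ∀ {x y} → x ≢ y → Obeys (verdict (kind x) (kind y) (δ x y)) (adjG x y)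
    obeys {x} {y} x≢y = obeys₀ (rotate-hexagon (index x)) x≢y
      (rotate-member₀ c (index x) (member x refl)) (rotate-member c (index x) (member y refl))

    forced : ∀ {k l m P Q} → Triples.Forced k l m P Q → ∀ {x y z} → kind x ≡ k → kind y ≡ l → kind z ≡ m →
             T (P (δ x y) (δ x z)) → T (Q (adjG x y) (adjG x z) (adjG y z))
    forced f {x} {y} {z} kx ky kz = forced₀ (rotate-hexagon (index x)) f
      (rotate-member₀ c (index x) (member x kx))
      (rotate-member c (index x) (member y ky)) (rotate-member c (index x) (member z kz))

    In : V → Kind → Fin 6 → Set
    In x k i = kind x ≡ k × index x ≡ i

    in? : ∀ x k i → Dec (In x k i)
    in? x k i = (kind x ≟ k) ×-dec (index x ≟ i)

    clique : ∀ {x y k i} → In x k i → In y k i → x ≢ y → Adj G x y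
    clique {x} {y} {k} {i} (refl , refl) (k≡ , i≡) x≢y = adjacent⇒ G (self-complete k (adjG x y)
      (subst (λ j → Obeys (verdict k k j) (adjG x y)) (trans (cong (_⊟ i) i≡) (⊟-self i))
        (subst (λ l → Obeys (verdict k l (δ x y)) (adjG x y)) k≡ (obeys x≢y))))

    -- Both classes are cliques, so if both cross edges were missing, `x`, `y`, `y′`, `x′` would be
    -- an induced C₄.
    nested : ∀ {k i l j} → (k , i) ≢ (l , j) → ∀ {x x′ y y′} → In x k i → In x′ k i → In y l j → In y′ l j →
             Adj G x y → Adj G x′ y′ → Adj G x y′ ⊎ Adj G x′ y
    nested classes≢ {x} {x′} {y} {y′} X X′ Y Y′ xy x′y′ with adj? G x y′ | adj? G x′ y
    ... | yes xy′ | _       = inj₁ xy′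
    ... | no _    | yes x′y = inj₂ x′y
    ... | no ¬xy′ | no ¬x′y = ⊥-elim (square xy (clique Y Y′ λ { refl → ¬xy′ xy }) (symm G x′y′)
            (clique X′ X λ { refl → ¬x′y xy }) ¬xy′ (¬x′y ∘ symm G) (disjoint X Y′) (disjoint X′ Y ∘ sym))
      where
      disjoint : ∀ {x y} → In x _ _ → In y _ _ → x ≢ y
      disjoint (refl , refl) (refl , refl) refl = classes≢ refl

    triangle : ∀ {x y z i j m} → In x A i → In y A j → In z A m → T (triad i j m) → Adj G x y → Adj G y z → Adj G x z
    triangle {x} {y} {z} (kx , refl) (ky , refl) (kz , refl) t xy yz =
      adjacent⇒ G (⇒-elim (adjG y z) (⇒-elim (adjG x y) (forced forced-AAA kx ky kz t) (⇒adjacent G xy)) (⇒adjacent G yz))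

    -- Nestedness compares the edge `uv` with the edge of the path `x`, `y`, `z` between the same
    -- two classes. Either cross edge it yields links `u` to the path, and `triangle` carries
    -- adjacency on to `x`.
    absorbed : ∀ {x y z u v i j m n} → In x A i → In y A j → In z A m → T (triad i j m) → Adj G x y → Adj G y z →
               In u A j → In v A n → n ≡ m ⊎ n ≡ i → Adj G u v → Adj G x u
    absorbed {i = i} {j} {m} X Y Z t xy yz U W (inj₁ refl) uv
      with nested (λ { refl → triad⇒≢ i j j t refl }) Y U Z W yz uv
    ... | inj₁ yv = triangle X W U (triad-swap i j m t) (triangle X Y W t xy yv) (symm G uv)
    ... | inj₂ uz = triangle X Z U (triad-swap i j m t) (triangle X Y Z t xy yz) (symm G uz)
    absorbed {i = i} {j} {m} X Y Z t xy yz U W (inj₂ refl) uv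
      with nested (λ { refl → triad⇒≢ m i i (triad-rotate j m i (triad-rotate i j m t)) refl }) Y U X W (symm G xy) uv
    ... | inj₂ ux = symm G ux
    ... | inj₁ yv = triangle X Z U (triad-swap i j m t) (triangle X Y Z t xy yz)
            (symm G (triangle U W Z (triad-swap j m i (triad-rotate i j m t)) uv (triangle W Y Z t (symm G yv) yz)))

    -- Which tags a signed vertex can split

    Reaches : Fin 6 → V → Set
    Reaches e x = ∃ λ y → kind y ≡ A × δ x y ≡ e × Adj G x y

    reaches? : ∀ e x → Dec (Reaches e x)
    reaches? e x = any? λ y → (kind y ≟ A) ×-dec (δ x y ≟ e) ×-dec adj? G x y

    sign : V → Sign
    sign x = signOf (reaches? (# 2) x) (reaches? (# 4) x)

    reaches-2⇒up : ∀ {x} → Reaches (# 2) x → sign x ≡ up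
    reaches-2⇒up {x} = signOf-up (reaches? (# 2) x) (reaches? (# 4) x)

    up⇒reaches-2 : ∀ {x} → sign x ≡ up → Reaches (# 2) x
    up⇒reaches-2 {x} = signOf≡up (reaches? (# 2) x) (reaches? (# 4) x)

    down⇒reaches-4 : ∀ {x} → sign x ≡ down → Reaches (# 4) x
    down⇒reaches-4 {x} = signOf≡down (reaches? (# 2) x) (reaches? (# 4) x)

    reaches-4⇒¬none : ∀ {x} → Reaches (# 4) x → sign x ≢ none
    reaches-4⇒¬none {x} = signOf≢none (reaches? (# 2) x) (reaches? (# 4) x)

    tag : V → Tag
    tag x = tagOf (kind x) (index x) (sign x)

    tag≡onA : ∀ {x i s} → tag x ≡ onA i s → In x A i × sign x ≡ s
    tag≡onA {x} e with tagOf≡onA (kind x) e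
    ... | k , i , s = (k , i) , s

    onA≡tag : ∀ {x i s} → In x A i → sign x ≡ s → tag x ≡ onA i s
    onA≡tag {x} (k , refl) refl = cong (λ k → tagOf k (index x) (sign x)) k

    same-a : ∀ {u u′} → kind u ≡ A → tag u ≡ tag u′ → In u′ A (index u) × sign u′ ≡ sign u
    same-a {u} k e = tag≡onA (trans (sym e) (onA≡tag {u} (k , refl) refl))

    same-b : ∀ {u u′} → kind u ≡ B → tag u ≡ tag u′ → In u′ B (index u)
    same-b {u} {u′} k e = tagOf≡onB (kind u′) (trans (sym e) (cong (λ k → tagOf k (index u) (sign u)) k))

    verdictFor : V → V → Verdict
    verdictFor x u = verdict (kind x) (kind u) (δ x u)

    -- A tag fixes the class for `A` and `B`, and `F-period` handles `F`. For `D`, applying `obeys`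
    -- to the distinct `u` and `u′` restricts their indices, and then `D-period` applies.
    same-verdict : ∀ x {u u′} → tag u ≡ tag u′ → u ≢ u′ → verdictFor x u ≡ verdictFor x u′
    same-verdict x {u} {u′} e u≢u′ = go (kind u) refl
      where
      both : ∀ {k i j} → In u k i → In u′ k j → verdict (kind x) k (i ⊟ index x) ≡ verdict (kind x) k (j ⊟ index x) →
             verdictFor x u ≡ verdictFor x u′
      both (p , refl) (q , refl) eq = trans (cong (λ k → verdict (kind x) k (δ x u)) p)
        (trans eq (cong (λ k → verdict (kind x) k (δ x u′)) (sym q)))
      go : ∀ k → kind u ≡ k → verdictFor x u ≡ verdictFor x u′
      go A p = both (p , refl) (proj₁ (same-a {u} p e)) refl
      go B p = both (p , refl) (same-b {u} p e) refl
      go F p = both (p , refl) (tagOf≡onF (kind u′) (trans (sym e) (cong (λ k → tagOf k (index u) (sign u)) p)) , refl)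
                    (F-period (kind x) (index x) (index u) (index u′))
      go D p = both (p , refl) (p′ , refl) (D-period (kind x) (index x) (index u) (index u′)
                 (D-meets (δ u u′) (adjG u u′)
                   (subst₂ (λ k l → Obeys (verdict k l (δ u u′)) (adjG u u′)) p p′ (obeys u≢u′))))
        where
        p′ : kind u′ ≡ D
        p′ = tagOf≡onD (kind u′) (trans (sym e) (cong (λ k → tagOf k (index u) (sign u)) p))

    uniform : ∀ {x u u′} → tag u ≡ tag u′ → u ≢ x → u′ ≢ x → ¬ T (isMixed (verdictFor x u)) → Adj G x u → Adj G x u′
    uniform {x} {u} {u′} e u≢x u′≢x pure xu with u ≟ u′
    ... | yes refl = xu
    ... | no u≢u′ = adjacent⇒ G (same-pure (verdictFor x u) (adjG x u) (adjG x u′) pure (obeys (u≢x ∘ sym))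
            (subst (λ v → Obeys v (adjG x u′)) (sym (same-verdict x e u≢u′)) (obeys (u′≢x ∘ sym))) (⇒adjacent G xu))

    -- A witness against the removability of `x`, stated without a set `S` so that the case analysis
    -- does not depend on one.
    record Splits (x u u′ : V) : Set where
      constructor splits
      field
        same-tag : tag u ≡ tag u′
        other      : u′ ≢ x
        near       : Adj G x u
        far        : ¬ Adj G x u′

    open Splits

    split⇒mixed : ∀ {x u u′} → Splits x u u′ →
                  (kind x ≡ A × kind u ≡ A × T (even (δ x u))) ⊎
                  (kind x ≡ A × kind u ≡ B × T (meets (δ x u))) ⊎
                  (kind x ≡ B × kind u ≡ A × T (meets (δ x u)))
    split⇒mixed {x} {u} s = mixed-cases (kind x) (kind u) (δ x u)
      (decidable-stable (T? _) λ pure →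
        far s (uniform (same-tag s) (λ { refl → irrefl G refl (near s) }) (other s) pure (near s)))

    -- With any other tag, `x` and `u` would lie on a path through all three classes A of one
    -- parity. The sign shared by `u` and `u′` gives `u′` a neighbour in one of the other two
    -- classes, so `absorbed` makes `u′` adjacent to `x`.
    A-split⇒partner : ∀ {x u u′} → kind x ≡ A → kind u ≡ A → sign x ≢ none → T (even (δ x u)) → Splits x u u′ →
                      tag u ≡ partner (tag x)
    A-split⇒partner {x} {u} {u′} kx ku s≢ ev (splits e _ xu ¬xu′)
      with ⊟-swap-24 (index x) (index u) ev | same-a {u} ku e
    ... | inj₁ (xu≡2 , ux≡4) | U′ , su′ = fromSign (sign u) refl
      where
      x-up : sign x ≡ up
      x-up = reaches-2⇒up {x} (u , ku , xu≡2 , xu)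
      fromSign : ∀ s → sign u ≡ s → tag u ≡ partner (tag x)
      fromSign none su = contradiction su (reaches-4⇒¬none {u} (x , kx , ux≡4 , symm G xu))
      fromSign down su = trans (onA≡tag {u} (ku , ⊟≡⇒⊞ (index x) (index u) (# 2) xu≡2) su)
        (cong partner (sym (onA≡tag {x} (kx , refl) x-up)))
      -- The path is `x`, `u`, `z`, and `v` lies in the class of `z`.
      fromSign up su with up⇒reaches-2 {u} su | up⇒reaches-2 {u′} (trans su′ su)
      ... | z , kz , uz≡2 , uz | v , kv , u′v≡2 , u′v = contradiction
        (absorbed {x} (kx , refl) (ku , refl) (kz , refl)
          (triad-22 (index x) (index u) (index z) xu≡2 uz≡2) xu uz U′ (kv , refl)
          (inj₁ (⊟-injective (index u) (index v) (index z)
            (trans (trans (cong (index v ⊟_) (sym (proj₂ U′))) u′v≡2) (sym uz≡2)))) u′v)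
        ¬xu′
    ... | inj₂ (xu≡4 , ux≡2) | U′ , su′ = fromSign (sign x) refl
      where
      u-up : sign u ≡ up
      u-up = reaches-2⇒up {u} (x , kx , ux≡2 , symm G xu)
      fromSign : ∀ s → sign x ≡ s → tag u ≡ partner (tag x)
      fromSign none sx = contradiction sx s≢
      fromSign down sx = trans (onA≡tag {u} (ku , ⊟≡⇒⊞ (index x) (index u) (# 4) xu≡4) u-up)
        (cong partner (sym (onA≡tag {x} (kx , refl) sx)))
      -- Here `triangle` turns the path `u`, `x`, `y` into the path `x`, `u`, `y`, and `v` lies in
      -- the class of `x`.
      fromSign up sx with up⇒reaches-2 {x} sx | up⇒reaches-2 {u′} (trans su′ u-up)
      ... | y , ky , xy≡2 , xy | v , kv , u′v≡2 , u′v = contradiction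
        (absorbed {x} (kx , refl) (ku , refl) (ky , refl) xuy xu
          (triangle (ku , refl) (kx , refl) (ky , refl) uxy (symm G xu) xy) U′ (kv , refl)
          (inj₂ (⊟-injective (index u) (index v) (index x)
            (trans (trans (cong (index v ⊟_) (sym (proj₂ U′))) u′v≡2) (sym ux≡2)))) u′v)
        ¬xu′
        where
        uxy : T (triad (index u) (index x) (index y))
        uxy = triad-22 (index u) (index x) (index y) ux≡2 xy≡2
        xuy : T (triad (index x) (index u) (index y))
        xuy = triad-swap _ _ _ (triad-rotate _ _ _ uxy)

    neighbour : ∀ {x} → sign x ≢ none → ∃ λ y → kind y ≡ A × T (even (δ x y)) × Adj G x y
    neighbour {x} s≢ = go (sign x) refl
      where
      go : ∀ s → sign x ≡ s → ∃ λ y → kind y ≡ A × T (even (δ x y)) × Adj G x y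
      go none e = contradiction e s≢
      go up e = let (y , ky , xy≡2 , xy) = up⇒reaches-2 {x} e in y , ky , subst (T ∘ even) (sym xy≡2) tt , xy
      go down e = let (y , ky , xy≡4 , xy) = down⇒reaches-4 {x} e in y , ky , subst (T ∘ even) (sym xy≡4) tt , xy

    -- The sign provides a neighbour `y` in A_{i+2} or A_{i-2}. By `forced-AAB`, `x` and `y` agree
    -- on this class B, and by `even-meets` `y` is not mixed on it.
    signed-uniform-on-B : ∀ {x u u′} → kind x ≡ A → kind u ≡ B → sign x ≢ none → T (meets (δ x u)) → tag u ≡ tag u′ →
                          Adj G x u → Adj G x u′
    signed-uniform-on-B {x} {u} {u′} kx ku s≢ m e xu with neighbour {x} s≢ | same-b {u} ku e
    ... | y , ky , ev , xy | ku′ , iu′ =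
      adjacent⇒ G (subst T (sym (transfer ku′ (subst (λ i → T (meets (i ⊟ index x))) (sym iu′) m))) (⇒adjacent G yu′))
      where
      transfer : ∀ {w} → kind w ≡ B → T (meets (δ x w)) → adjG x w ≡ adjG y w
      transfer kw m = ≡ᵇ⇒≡ _ _ (⇒-elim (adjG x y)
        (forced forced-AAB kx ky kw (Equivalence.from T-∧ (ev , m))) (⇒adjacent G xy))
      u≢y : ∀ {w} → kind w ≡ B → w ≢ y
      u≢y kw refl with trans (sym ky) kw
      ... | ()
      pure : ¬ T (isMixed (verdictFor y u))
      pure = subst₂ (λ k l → ¬ T (isMixed (verdict k l (δ y u)))) (sym ky) (sym ku)
               (even-meets (index x) (index y) (index u) ev m)
      yu′ : Adj G y u′
      yu′ = uniform e (u≢y ku) (u≢y ku′) pure (adjacent⇒ G (subst T (transfer ku m) (⇒adjacent G xu)))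

    signed-split⇒partner : ∀ {x u u′} → kind x ≡ A → sign x ≢ none → Splits x u u′ → tag u ≡ partner (tag x)
    signed-split⇒partner {x} {u} kx s≢ s with split⇒mixed s
    ... | inj₁ (_ , ku , ev)          = A-split⇒partner kx ku s≢ ev s
    ... | inj₂ (inj₁ (_ , ku , m))    = contradiction (signed-uniform-on-B kx ku s≢ m (same-tag s) (near s)) (far s)
    ... | inj₂ (inj₂ (kx′ , _ , _)) with trans (sym kx) kx′
    ...   | ()

    -- Finding a removable vertex

    code-tag : V → Fin 26
    code-tag = code ∘ tag

    unsplit⇒removable : ∀ {S x} → (∀ {u u′} → u ∈ˢ S → u′ ∈ˢ S → ¬ Splits x u u′) → Removable G code-tag S x
    unsplit⇒removable h u∈S u′∈S u≢x u′≢x e xu =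
      decidable-stable (adj? G _ _) λ ¬xu′ → h u∈S u′∈S (splits (code-injective e) u′≢x xu ¬xu′)

    RemovableIn : Subset (order G) → Set
    RemovableIn S = ∃ λ x → x ∈ˢ S × Removable G code-tag S x

    Class : Subset (order G) → Tag → V → Set
    Class S l x = x ∈ˢ S × tag x ≡ l

    class? : ∀ S l x → Dec (Class S l x)
    class? S l x = (x ∈? S) ×-dec (tag x ≟ᵗ l)

    -- Each of the tags `p` and `q` can be split only on the other, so it suffices to take a vertex
    -- of `p` complete to `q` within `S`, or one of `q` anticomplete to `p`.
    pair-removable : ∀ S p q →
      (∀ {x x′ y y′} → Class S p x → Class S p x′ → Class S q y → Class S q y′ →
        Adj G x y → Adj G x′ y′ → Adj G x y′ ⊎ Adj G x′ y) →
      (∀ {x u u′} → tag x ≡ p → Splits x u u′ → tag u ≡ q) →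
      (∀ {y u u′} → tag y ≡ q → Splits y u u′ → tag u ≡ p) →
      ∃ (λ v → Class S p v ⊎ Class S q v) → RemovableIn S
    pair-removable S p q nest p-split q-split ne with extremal (adj? G) (class? S p) (class? S q) nest ne
    ... | inj₁ (x , (x∈S , lx) , all) = x , x∈S , unsplit⇒removable λ _ u′∈S s →
            far s (all (u′∈S , trans (sym (same-tag s)) (p-split lx s)))
    ... | inj₂ (y , (y∈S , ly) , isolated) = y , y∈S , unsplit⇒removable λ u∈S _ s →
            isolated (u∈S , q-split ly s) (symm G (near s))

    signed-split : ∀ {x i s u u′} → s ≢ none → tag x ≡ onA i s → Splits x u u′ → tag u ≡ partner (onA i s)
    signed-split {x} s≢ lx sp with tag≡onA {x} lx
    ... | (kx , _) , sx = trans (signed-split⇒partner kx (λ e → s≢ (trans (sym sx) e)) sp) (cong partner lx)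

    -- Both equations are arguments, so that either `i` or `j` may be the index at hand.
    signed-removable : ∀ S i j → i ⊞ # 2 ≡ j → j ⊞ # 4 ≡ i →
                       ∃ (λ v → Class S (onA i up) v ⊎ Class S (onA j down) v) → RemovableIn S
    signed-removable S i j refl ji ne = pair-removable S (onA i up) (onA j down)
      (λ X X′ Y Y′ → nested (λ e → ⊞2≢ i (sym (cong proj₂ e))) (in-class X) (in-class X′) (in-class Y) (in-class Y′))
      (λ lx s → signed-split (λ ()) lx s)
      (λ ly s → trans (signed-split (λ ()) ly s) (cong (λ i → onA i up) ji))
      ne
      where
      in-class : ∀ {x i s} → Class S (onA i s) x → In x A i
      in-class {x} (_ , lx) = proj₁ (tag≡onA {x} lx)

    module _ (S : Subset (order G)) (unsigned : ∀ {x} → x ∈ˢ S → kind x ≡ A → sign x ≡ none) where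

      -- Signs refer to all of `G`, so the absence of a sign on `x` excludes `u` even outside `S`.
      no-A-A-edge : ∀ {x u} → x ∈ˢ S → kind x ≡ A → kind u ≡ A → T (even (δ x u)) → ¬ Adj G x u
      no-A-A-edge {x} {u} x∈S kx ku ev xu with ⊟-swap-24 (index x) (index u) ev
      ... | inj₂ (xu≡4 , _) = reaches-4⇒¬none {x} (u , ku , xu≡4 , xu) (unsigned x∈S kx)
      ... | inj₁ (xu≡2 , _) with trans (sym (unsigned x∈S kx)) (reaches-2⇒up {x} (u , ku , xu≡2 , xu))
      ...   | ()

      A-split : ∀ {x u u′} → x ∈ˢ S → kind x ≡ A → Splits x u u′ → kind u ≡ B × T (meets (δ x u))
      A-split {x} x∈S kx s with split⇒mixed s
      ... | inj₁ (_ , ku , ev)         = contradiction (near s) (no-A-A-edge x∈S kx ku ev)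
      ... | inj₂ (inj₁ (_ , ku , m))   = ku , m
      ... | inj₂ (inj₂ (kx′ , _ , _)) with trans (sym kx) kx′
      ...   | ()

      B-split : ∀ {x u u′} → kind x ≡ B → Splits x u u′ → kind u ≡ A × T (meets (δ x u))
      B-split {x} kx s with split⇒mixed s
      ... | inj₂ (inj₂ (_ , ku , m))  = ku , m
      ... | inj₁ (kx′ , _) with trans (sym kx) kx′
      ...   | ()
      B-split {x} kx s | inj₂ (inj₁ (kx′ , _)) with trans (sym kx) kx′
      ...   | ()

      module _ {m : Fin 6} {w : V} (w∈S : w ∈ˢ S) (W : In w B m) where

        X : Fin 6 → V → Set
        X j x = x ∈ˢ S × In x A j

        Y : V → Set
        Y y = y ∈ˢ S × In y B m

        x? : ∀ j x → Dec (X j x)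
        x? j x = (x ∈? S) ×-dec in? x A j

        extreme : ∀ j → (∃ λ x → X j x × (∀ {y} → Y y → Adj G x y)) ⊎ (∃ λ y → Y y × (∀ {x} → X j x → ¬ Adj G x y))
        extreme j = extremal (adj? G) (x? j) (λ y → (y ∈? S) ×-dec in? y B m)
          (λ (_ , p) (_ , p′) (_ , q) (_ , q′) → nested (λ ()) p p′ q q′) (w , inj₂ (w∈S , W))

        -- An unsigned vertex of A_m or A_{m+3} can split only B_m and B_{m+3}. Within `S`, `x` is
        -- complete to the first; as it sees `w`, `forced-ABB` makes it complete to the second.
        complete⇒removable : ∀ {j x} → j ≡ m ⊎ j ≡ opposite m → X j x → (∀ {y} → Y y → Adj G x y) → RemovableIn S
        complete⇒removable {j} {x} j≡ (x∈S , kx , refl) all =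
          x , x∈S , unsplit⇒removable λ _ u′∈S s → absurd u′∈S s (A-split x∈S kx s)
          where
          absurd : ∀ {u u′} → u′ ∈ˢ S → Splits x u u′ → kind u ≡ B × T (meets (δ x u)) → ⊥
          absurd {u} {u′} u′∈S s (ku , mu) with same-b {u} ku (same-tag s) | index u ≟ m
          ... | ku′ , iu′ | yes refl = far s (all (u′∈S , ku′ , iu′))
          ... | ku′ , iu′ | no u≢m   = far s (adjacent⇒ G (⇒-elim (adjG x w)
                  (forced forced-ABB {x} {w} {u′} kx (proj₁ W) ku′
                    (subst₂ (λ i j → T (meets (i ⊟ index x) ∧ meets (j ⊟ index x) ∧ not (does (i ⊟ index x ≟ j ⊟ index x))))
                      (sym (proj₂ W)) (sym iu′)
                      (ABB-guard (index x) m (index u) (meets-opposite (index x) m j≡) mu (u≢m ∘ sym))))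
                  (⇒adjacent G (all (w∈S , W)))))

        B-removable : ∀ {y} → Y y →
                      (∀ u u′ → u ∈ˢ S → index u ≡ m ⊎ index u ≡ opposite m → kind u ≡ A → ¬ Splits y u u′) →
                      RemovableIn S
        B-removable {y} (y∈S , ky , iy) h = y , y∈S , unsplit⇒removable λ {u} {u′} u∈S _ s →
          let (ku , mu) = B-split ky s
              um = subst (λ j → T (meets (j ⊟ index u))) iy (meets-sym (index y) (index u) mu)
          in h u u′ u∈S (meets-cases (index u) m um) ku s

        -- If no vertex of A_m is complete to B_m within `S`, some `y` in B_m misses all of A_m.
        -- When A_m has a vertex `x₀` in `S`, `forced-AAB′` makes `y` complete to A_{m+3}, so `y`
        -- splits nothing.
        B-class-removable : RemovableIn S
        B-class-removable with extreme m
        ... | inj₁ (x , Xx , all) = complete⇒removable (inj₁ refl) Xx all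
        ... | inj₂ (y , Yy , anti) with any? (x? m)
        ...   | yes (x₀ , x₀∈S , kx₀ , ix₀) = B-removable Yy λ where
                  u _ u∈S (inj₁ iu) ku s → anti (u∈S , ku , iu) (symm G (near s))
                  u u′ u∈S (inj₂ iu) ku s →
                    let ((ku′ , iu′) , _) = same-a {u} ku (same-tag s)
                        guard = subst₂ (λ i j → T (does (i ⊟ index x₀ ≟ # 3) ∧ meets (j ⊟ index x₀)))
                                  (sym (trans iu′ iu)) (sym (proj₂ (proj₂ Yy)))
                                  (subst (λ i → T (does (opposite m ⊟ i ≟ # 3) ∧ meets (m ⊟ i))) (sym ix₀) (AAB-guard m))
                    in [ (λ x₀y → anti (x₀∈S , kx₀ , ix₀) (adjacent⇒ G x₀y)) , (λ u′y → far s (symm G (adjacent⇒ G u′y))) ]′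
                       (Equivalence.to T-∨ (forced forced-AAB′ {x₀} {u′} {y} kx₀ ku′ (proj₁ (proj₂ Yy)) guard))
        -- With A_m absent from `S`, only A_{m+3} can be split by B_m, so the extreme vertex is
        -- taken there.
        ...   | no empty with extreme (opposite m)
        ...     | inj₁ (x , Xx , all) = complete⇒removable (inj₂ refl) Xx all
        ...     | inj₂ (y′ , Yy′ , anti′) = B-removable Yy′ λ where
                    u _ u∈S (inj₁ iu) ku s → empty (u , u∈S , ku , iu)
                    u _ u∈S (inj₂ iu) ku s → anti′ (u∈S , ku , iu) (symm G (near s))

      -- Without vertices of kind `B` in `S`, only pairs of classes A remain mixed, and these have
      -- no edges at unsigned vertices, so any vertex serves.
      unsigned-removable : ∀ {v} → v ∈ˢ S → RemovableIn S
      unsigned-removable {v} v∈S with any? (λ x → (x ∈? S) ×-dec (kind x ≟ B))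
      ... | yes (w , w∈S , kw) = B-class-removable w∈S (kw , refl)
      ... | no no-B = v , v∈S , unsplit⇒removable λ u∈S _ s → absurd u∈S s (split⇒mixed s)
        where
        absurd : ∀ {u u′} → u ∈ˢ S → Splits v u u′ →
                 (kind v ≡ A × kind u ≡ A × T (even (δ v u))) ⊎ (kind v ≡ A × kind u ≡ B × T (meets (δ v u))) ⊎
                 (kind v ≡ B × kind u ≡ A × T (meets (δ v u))) → ⊥
        absurd u∈S s (inj₁ (kv , ku , ev))      = no-A-A-edge v∈S kv ku ev (near s)
        absurd u∈S s (inj₂ (inj₁ (_ , ku , _))) = no-B (_ , u∈S , ku)
        absurd u∈S s (inj₂ (inj₂ (kv , _)))     = no-B (_ , v∈S , kv)

    removable : ∀ S → Nonempty S → RemovableIn S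
    removable S (v , v∈S) with any? (λ x → (x ∈? S) ×-dec (kind x ≟ A) ×-dec ¬? (sign x ≟ none))
    ... | no all-none = unsigned-removable S
            (λ {x} x∈S kx → decidable-stable (sign x ≟ none) λ s≢ → all-none (x , x∈S , kx , s≢)) v∈S
    ... | yes (x , x∈S , kx , s≢) = go (sign x) refl
      where
      tagged : ∀ {s} → sign x ≡ s → Class S (onA (index x) s) x
      tagged sx = x∈S , onA≡tag {x} (kx , refl) sx
      go : ∀ s → sign x ≡ s → RemovableIn S
      go none sx = contradiction sx s≢
      go up   sx = signed-removable S (index x) (index x ⊞ # 2) refl (⊞2⊞4 (index x)) (x , inj₁ (tagged sx))
      -- The partner of a `down` vertex of A_i is `up` in A_{i+4}, which becomes the first index of
      -- the pair.
      go down sx = signed-removable S (index x ⊞ # 4) (index x) (⊞4⊞2 (index x)) refl (x , inj₂ (tagged sx))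

    -- `c zero` witnesses that `G` has a vertex, as every expression requires.
    constructible : ConstructibleWith 27 G
    constructible = linearConstruction G code-tag removable (c zero)

theorem2p4 : (∀ G → (4 K₁ ∷ C 4 ∷ P 6 ∷ []) -Free G → C 6 ⊑ G → CliqueWidth≤ G 27)
    × BoundedCliqueWidth (λ G → (4 K₁ ∷ C 4 ∷ P 6 ∷ []) -Free G × C 6 ⊑ G)
theorem2p4 = bound , 27 , λ G (free , C₆⊑G) → bound G free C₆⊑G
  where
  bound : ∀ G → (4 K₁ ∷ C 4 ∷ P 6 ∷ []) -Free G → C 6 ⊑ G → CliqueWidth≤ G 27
  bound G free (f , adj⇔) = constructible⇒cliqueWidth≤ {G = G} (constructible G free (describes λ u v →
    trans (sym (does-⇔ (adj⇔ u v) (adj? (C 6) u v) (adj? G _ _))) (sym (entry-table (C 6) u v))))
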